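{- Let $G$ be a finite connected $P_5$-free graph with $\alpha(G)\ge 3$. Then there is a three-vertex induced path of $G$ with vertices $a,b,c$ in this order (so $ab,bc\in E(G)$ and $ac\notin E(G)$) such that every neighbour of $c$ is also adjacent to at least one of $a,b$.
   Context: Graphs are finite and simple. $P_5$ is the path on five vertices; $G$ is $P_5$-free if no induced subgraph of $G$ is isomorphic to $P_5$. $\alpha(G)$ denotes the independence number of $G$, the maximum size of a stable (independent) set of vertices. -}

module Defs where

open import Data.Nat using (ℕ)
open import Data.Fin using (Fin)
open import Data.Product using (_×_; Σ; ∃; ∃-syntax; _,_)
open import Data.Sum using (_⊎_)
open import Relation.Nullary using (¬_; Dec)
open import Relation.Binary.PropositionalEquality using (_≡_)
open import Data.Fin.Subset using (Subset; _∈_; ∣_∣)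
open import Data.Nat using (_≥_)

record Graph (n : ℕ) : Set₁ where
  field
    Adj     : Fin n → Fin n → Set
    adj-dec : ∀ u v → Dec (Adj u v)
    sym     : ∀ {u v} → Adj u v → Adj v u
    irrefl  : ∀ {u} → ¬ Adj u u

open Graph public

data Walk {n : ℕ} (G : Graph n) : Fin n → Fin n → Set where
  here : ∀ {u} → Walk G u u
  step : ∀ {u w v} → Adj G u w → Walk G w v → Walk G u v

Connected : ∀ {n} → Graph n → Set
Connected {n} G = ∀ (u v : Fin n) → Walk G u v

InducedP5 : ∀ {n} → Graph n → (v₁ v₂ v₃ v₄ v₅ : Fin n) → Set
InducedP5 G v₁ v₂ v₃ v₄ v₅ =
  ¬ v₁ ≡ v₂ × ¬ v₁ ≡ v₃ × ¬ v₁ ≡ v₄ × ¬ v₁ ≡ v₅ ×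
  ¬ v₂ ≡ v₃ × ¬ v₂ ≡ v₄ × ¬ v₂ ≡ v₅ ×
  ¬ v₃ ≡ v₄ × ¬ v₃ ≡ v₅ ×
  ¬ v₄ ≡ v₅ ×
  Adj G v₁ v₂ × Adj G v₂ v₃ × Adj G v₃ v₄ × Adj G v₄ v₅ ×
  ¬ Adj G v₁ v₃ × ¬ Adj G v₁ v₄ × ¬ Adj G v₁ v₅ ×
  ¬ Adj G v₂ v₄ × ¬ Adj G v₂ v₅ ×
  ¬ Adj G v₃ v₅

P5Free : ∀ {n} → Graph n → Set
P5Free {n} G = ∀ (v₁ v₂ v₃ v₄ v₅ : Fin n) → ¬ InducedP5 G v₁ v₂ v₃ v₄ v₅

Stable : ∀ {n} → Graph n → Subset n → Set
Stable {n} G S = ∀ (u v : Fin n) → u ∈ S → v ∈ S → ¬ Adj G u v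

IndepAtLeast : ∀ {n} → Graph n → ℕ → Set
IndepAtLeast {n} G k = Σ (Subset n) λ S → Stable G S × ∣ S ∣ ≥ k

{-# OPTIONS --safe #-}
module Submission where

-- Work in the complement H of a counterexample G, where "every induced P₃ extends to an induced P₄" and P₅-freeness
-- say that H has no induced house and that certain extensions exist. These properties are inherited by the link of
-- every vertex and by the deletion of one of two twins, so in a minimal H containing a triangle, H has no K₄ and no
-- twins; then any two nonadjacent vertices have exactly two common neighbours, and these are adjacent. Hence every
-- link is a Moore graph of diameter two, of degree ℓ say, and H is strongly regular with parameters (ℓ² + 1, ℓ, 2).
-- Infinite graphs of this kind exist; finite ones are excluded by their eigenvalues. If the discriminant 4 ℓ - 3 of the
-- link is not a square, then the two irrational eigenvalues have equal multiplicity and the trace forces ℓ = 2; for H,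
-- with discriminant ℓ (5 ℓ - 4), the same argument gives a contradiction for every ℓ ≥ 2. But 12 is not a square, and
-- both discriminants are squares only for ℓ = 1.

open import Defs
open import Data.Nat as ℕ using (ℕ; zero; suc)
import Data.Nat.Properties as ℕ
import Data.Nat.Tactic.RingSolver as ℕ-Solver
open import Data.Nat.Divisibility using (_∣_; divides; ∣1⇒≡1; *-cancelʳ-∣; ∣-refl; ∣-antisym; ∣m+n∣m⇒∣n; m∣m*n; ∣n⇒∣m*n; _∣?_)
open import Data.Nat.Coprimality using (Coprime; coprime-divisor)
open import Data.Nat.GCD using (gcd; gcd[m,n]∣m; gcd[m,n]∣n; gcd[m,n]≢0; gcd-greatest)
open import Data.Integer as ℤ using (ℤ; +_; -_; _+_; _*_; _-_; 0ℤ; 1ℤ; ∣_∣)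
import Data.Integer.Properties as ℤ
open import Data.Integer.Tactic.RingSolver using (solve-∀)
open import Data.Fin using (Fin; zero; suc; punchIn; punchOut; _≟_)
open import Data.Fin.Properties using (any?; all?; injective⇒≤; suc-injective; punchIn-injective; punchInᵢ≢i; punchIn-punchOut)
open import Data.Product using (_×_; Σ; ∃-syntax; _,_; proj₁; proj₂)
open import Data.Sum as Sum⊎ using (_⊎_; inj₁; inj₂)
open import Data.Empty using (⊥; ⊥-elim)
open import Function using (_∘_; case_of_)
open import Relation.Nullary using (¬_; Dec; yes; no; ¬?; _×-dec_; _⊎-dec_; _→-dec_; contradiction)
open import Relation.Nullary.Decidable using (decidable-stable; from-no)
open import Relation.Binary.PropositionalEquality as ≡ using (_≡_; _≢_; refl; trans; cong; cong₂; subst; module ≡-Reasoning)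
open import Data.Nat.Induction using (<-wellFounded)
open import Induction.WellFounded using (Acc; acc)
open import Data.Fin.Subset as Subset using (Subset; _∈_; inside; outside)
open import Data.Vec using (_∷_; here; there)
import Algebra.Properties.Semiring.Sum ℤ.+-*-semiring as Sum

-- Opaque, since unification otherwise unfolds sums down to the definition of integer addition.
opaque
  sum : ∀ {n} → (Fin n → ℤ) → ℤ
  sum = Sum.sum

  sum-suc : ∀ {n} (t : Fin (suc n) → ℤ) → sum t ≡ t zero + sum (t ∘ suc)
  sum-suc t = refl

  sum-remove : ∀ {n} (i : Fin (suc n)) (t : Fin (suc n) → ℤ) → sum t ≡ t i + sum (t ∘ punchIn i)
  sum-remove i t = Sum.sum-remove {i = i} t

  sum-cong : ∀ {n} {s t : Fin n → ℤ} → (∀ i → s i ≡ t i) → sum s ≡ sum t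
  sum-cong = Sum.sum-cong-≗

  sum-empty : (t : Fin 0 → ℤ) → sum t ≡ 0ℤ
  sum-empty t = refl

  sum-zero : ∀ {n} (t : Fin n → ℤ) → (∀ i → t i ≡ 0ℤ) → sum t ≡ 0ℤ
  sum-zero {n} t t≗0 = trans (Sum.sum-cong-≗ t≗0) (Sum.sum-replicate-zero n)

  sum-distrib-+ : ∀ {n} (s t : Fin n → ℤ) → sum (λ i → s i + t i) ≡ sum s + sum t
  sum-distrib-+ = Sum.∑-distrib-+

  sum-comm : ∀ {m n} (f : Fin m → Fin n → ℤ) → sum (λ i → sum (λ j → f i j)) ≡ sum (λ j → sum (λ i → f i j))
  sum-comm = Sum.∑-comm

  *-distribˡ-sum : ∀ {n} x (t : Fin n → ℤ) → x * sum t ≡ sum (λ i → x * t i)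
  *-distribˡ-sum = Sum.*-distribˡ-sum

  *-distribʳ-sum : ∀ {n} x (t : Fin n → ℤ) → sum t * x ≡ sum (λ i → t i * x)
  *-distribʳ-sum = Sum.*-distribʳ-sum

-- Squares of natural numbers

coprime-cofactors : ∀ b c → b ≢ 0 → ∃[ g ] ∃[ b′ ] ∃[ c′ ] ℕ.NonZero g × b ≡ b′ ℕ.* g × c ≡ c′ ℕ.* g × Coprime b′ c′
coprime-cofactors b c b≢0 with gcd[m,n]∣m b c | gcd[m,n]∣n b c
... | divides b′ b≡b′g | divides c′ c≡c′g = gcd b c , b′ , c′ , g≢0 , b≡b′g , c≡c′g , b′⊥c′
  where
  instance
    g≢0 : ℕ.NonZero (gcd b c)
    g≢0 = ℕ.≢-nonZero (gcd[m,n]≢0 b c (inj₁ b≢0))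
  b′⊥c′ : Coprime b′ c′
  b′⊥c′ {i} (divides p b′≡pi , divides q c′≡qi) = ∣1⇒≡1
    (*-cancelʳ-∣ (gcd b c) (subst (i ℕ.* gcd b c ∣_) (≡.sym (ℕ.*-identityˡ (gcd b c)))
      (gcd-greatest
        (divides p (trans b≡b′g (trans (cong (ℕ._* gcd b c) b′≡pi) (ℕ.*-assoc p i (gcd b c)))))
        (divides q (trans c≡c′g (trans (cong (ℕ._* gcd b c) c′≡qi) (ℕ.*-assoc q i (gcd b c))))))))

-- After division by the gcd, `b′` divides `c′²` and is coprime to `c′`, so it is 1. This removes
-- the factor `β²` that deflation brings into the discriminant.
square-quotient : ∀ b c d → b ≢ 0 → c ℕ.* c ≡ d ℕ.* (b ℕ.* b) → ∃[ s ] s ℕ.* s ≡ d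
square-quotient b c d b≢0 c²≡db² with coprime-cofactors b c b≢0
... | g , b′ , c′ , g≢0 , refl , refl , b′⊥c′ = c′ , (begin
  c′ ℕ.* c′         ≡⟨ c′²≡db′² ⟩
  d ℕ.* (b′ ℕ.* b′) ≡⟨ cong (λ x → d ℕ.* (x ℕ.* x)) (b′⊥c′ (∣-refl , b′∣c′)) ⟩
  d ℕ.* 1           ≡⟨ ℕ.*-identityʳ d ⟩
  d                 ∎)
  where
  open ≡-Reasoning

  instance
    g²≢0 : ℕ.NonZero (g ℕ.* g)
    g²≢0 = ℕ.m*n≢0 g g {{g≢0}} {{g≢0}}

  regroup : ∀ x y → x ℕ.* x ℕ.* (y ℕ.* y) ≡ (x ℕ.* y) ℕ.* (x ℕ.* y)
  regroup = ℕ-Solver.solve-∀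

  c′²≡db′² : c′ ℕ.* c′ ≡ d ℕ.* (b′ ℕ.* b′)
  c′²≡db′² = ℕ.*-cancelʳ-≡ _ _ (g ℕ.* g) (begin
    c′ ℕ.* c′ ℕ.* (g ℕ.* g)           ≡⟨ regroup c′ g ⟩
    (c′ ℕ.* g) ℕ.* (c′ ℕ.* g)         ≡⟨ c²≡db² ⟩
    d ℕ.* ((b′ ℕ.* g) ℕ.* (b′ ℕ.* g)) ≡⟨ cong (d ℕ.*_) (regroup b′ g) ⟨
    d ℕ.* (b′ ℕ.* b′ ℕ.* (g ℕ.* g))   ≡⟨ ℕ.*-assoc d _ _ ⟨
    d ℕ.* (b′ ℕ.* b′) ℕ.* (g ℕ.* g)   ∎)

  b′∣c′ : b′ ∣ c′
  b′∣c′ = coprime-divisor {n = c′} b′⊥c′ (divides (d ℕ.* b′) (trans c′²≡db′² (≡.sym (ℕ.*-assoc d b′ b′))))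

-- With `l = l′ g` and `y = y′ g` for the gcd `g`, the equation becomes `l′ k = g y′²`. As `l′` is
-- coprime to `y′` and `g` to `k`, `l′` and `g` divide each other.
coprime-factor-square : ∀ l k y → l ≢ 0 → Coprime l k → l ℕ.* k ≡ y ℕ.* y → ∃[ a ] a ℕ.* a ≡ l
coprime-factor-square l k y l≢0 l⊥k lk≡y² with coprime-cofactors l y l≢0
... | g , l′ , y′ , g≢0 , refl , refl , l′⊥y′ = g , cong (ℕ._* g) (∣-antisym g∣l′ l′∣g)
  where
  open ≡-Reasoning

  l′k≡gy′² : l′ ℕ.* k ≡ y′ ℕ.* (y′ ℕ.* g)
  l′k≡gy′² = ℕ.*-cancelʳ-≡ _ _ g {{g≢0}} (trans (swap l′ k g) (trans lk≡y² (regroup y′ g)))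
    where
    swap : ∀ x y z → x ℕ.* y ℕ.* z ≡ x ℕ.* z ℕ.* y
    swap = ℕ-Solver.solve-∀
    regroup : ∀ y g → (y ℕ.* g) ℕ.* (y ℕ.* g) ≡ y ℕ.* (y ℕ.* g) ℕ.* g
    regroup = ℕ-Solver.solve-∀

  l′∣g : l′ ∣ g
  l′∣g = coprime-divisor l′⊥y′ (coprime-divisor {n = y′} l′⊥y′ (divides k (trans (≡.sym l′k≡gy′²) (ℕ.*-comm l′ k))))

  g⊥k : Coprime g k
  g⊥k (d∣g , d∣k) = l⊥k (∣n⇒∣m*n l′ d∣g , d∣k)

  g∣l′ : g ∣ l′
  g∣l′ = coprime-divisor {n = k} g⊥k (divides (y′ ℕ.* y′) (trans (ℕ.*-comm k l′) (trans l′k≡gy′² (≡.sym (ℕ.*-assoc y′ y′ g)))))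

square-+∣∣ : ∀ i → i * i ≡ + (∣ i ∣ ℕ.* ∣ i ∣)
square-+∣∣ (+ n) = ≡.sym (ℤ.pos-* n n)
square-+∣∣ ℤ.-[1+ n ] = refl

-- Integer matrices

[_] : {P : Set} → Dec P → ℤ
[ yes _ ] = 1ℤ
[ no  _ ] = 0ℤ

Matrix : ℕ → Set
Matrix n = Fin n → Fin n → ℤ

infixl 7 _·_
_·_ : ∀ {n} → Matrix n → Matrix n → Matrix n
(A · B) i j = sum λ k → A i k * B k j

tr : ∀ {n} → Matrix n → ℤ
tr A = sum λ i → A i i

δ : ∀ {n} → Matrix n
δ i j = [ i ≟ j ]

δ-refl : ∀ {n} (i : Fin n) → δ i i ≡ 1ℤ
δ-refl i with i ≟ i
... | yes _ = refl
... | no ¬p = contradiction refl ¬p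

δ-≢ : ∀ {n} {i j : Fin n} → i ≢ j → δ i j ≡ 0ℤ
δ-≢ {i = i} {j} i≢j with i ≟ j
... | yes p = contradiction p i≢j
... | no _ = refl

δ-sym : ∀ {n} (i j : Fin n) → δ i j ≡ δ j i
δ-sym i j with i ≟ j
... | yes refl = ≡.sym (δ-refl i)
... | no i≢j = ≡.sym (δ-≢ (i≢j ∘ ≡.sym))

δ-injective : ∀ {m n} (f : Fin m → Fin n) → (∀ {i j} → f i ≡ f j → i ≡ j) → ∀ i j → δ (f i) (f j) ≡ δ i j
δ-injective f inj i j with i ≟ j
... | yes refl = δ-refl (f i)
... | no i≢j = δ-≢ (i≢j ∘ inj)

sum-δ : ∀ {n} (i : Fin n) (t : Fin n → ℤ) → sum (λ k → δ i k * t k) ≡ t i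
sum-δ {suc n} i t = begin
  sum (λ k → δ i k * t k)  ≡⟨ sum-remove i (λ k → δ i k * t k) ⟩
  δ i i * t i + sum (λ k → δ i (punchIn i k) * t (punchIn i k))
    ≡⟨ cong₂ _+_ (trans (cong (_* t i) (δ-refl i)) (ℤ.*-identityˡ (t i)))
         (sum-zero _ λ k → cong (_* t (punchIn i k)) (δ-≢ (punchInᵢ≢i i k ∘ ≡.sym))) ⟩
  t i + 0ℤ                 ≡⟨ ℤ.+-identityʳ (t i) ⟩
  t i                      ∎
  where open ≡-Reasoning

sum-linear : ∀ {n} a b (s t : Fin n → ℤ) → sum (λ i → a * s i + b * t i) ≡ a * sum s + b * sum t
sum-linear a b s t = trans (sum-distrib-+ (λ i → a * s i) (λ i → b * t i))
  (≡.sym (cong₂ _+_ (*-distribˡ-sum a s) (*-distribˡ-sum b t)))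

sum-bilinear : ∀ {n} (a b c d : ℤ) (s t u v : Fin n → ℤ) →
  sum (λ k → (a * s k + b * t k) * (c * u k + d * v k)) ≡
  a * c * sum (λ k → s k * u k) + a * d * sum (λ k → s k * v k) +
  (b * c * sum (λ k → t k * u k) + b * d * sum (λ k → t k * v k))
sum-bilinear a b c d s t u v = begin
  sum (λ k → (a * s k + b * t k) * (c * u k + d * v k))
    ≡⟨ sum-cong (λ k → expand a b c d (s k) (t k) (u k) (v k)) ⟩
  sum (λ k → (a * c * (s k * u k) + a * d * (s k * v k)) + (b * c * (t k * u k) + b * d * (t k * v k)))
    ≡⟨ sum-distrib-+ (λ k → a * c * (s k * u k) + a * d * (s k * v k)) (λ k → b * c * (t k * u k) + b * d * (t k * v k)) ⟩
  sum (λ k → a * c * (s k * u k) + a * d * (s k * v k)) + sum (λ k → b * c * (t k * u k) + b * d * (t k * v k))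
    ≡⟨ cong₂ _+_ (sum-linear (a * c) (a * d) (λ k → s k * u k) (λ k → s k * v k))
                   (sum-linear (b * c) (b * d) (λ k → t k * u k) (λ k → t k * v k)) ⟩
  a * c * sum (λ k → s k * u k) + a * d * sum (λ k → s k * v k) +
    (b * c * sum (λ k → t k * u k) + b * d * sum (λ k → t k * v k)) ∎
  where
  open ≡-Reasoning
  expand : ∀ a b c d s t u v → (a * s + b * t) * (c * u + d * v) ≡
    a * c * (s * u) + a * d * (s * v) + (b * c * (t * u) + b * d * (t * v))
  expand = solve-∀

-- B induces a map on the quotient by the span of e₀ and B e₀; its matrix has entries
-- B i j - B i 0 * B p j / B p 0, here multiplied by β = B p 0 to remain integral.
module Deflation {n} (B : Matrix (suc (suc n))) (d : ℕ)
                 (B²≡d : ∀ i j → (B · B) i j ≡ + d * δ i j) (p : Fin (suc n)) where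
  open ≡-Reasoning

  β : ℤ
  β = B (suc p) zero

  survivor : Fin n → Fin (suc (suc n))
  survivor i = suc (punchIn p i)

  scaled : Matrix (suc (suc n))
  scaled i j = β * B i j + (- B i zero) * B (suc p) j

  deflated : Matrix n
  deflated i j = scaled (survivor i) (survivor j)

  scaled-column : ∀ i → scaled i zero ≡ 0ℤ
  scaled-column i = cancel β (B i zero)
    where
    cancel : ∀ x y → x * y + (- y) * x ≡ 0ℤ
    cancel = solve-∀

  scaled-row : ∀ j → scaled (suc p) j ≡ 0ℤ
  scaled-row j = cancel β (B (suc p) j)
    where
    cancel : ∀ x y → x * y + (- x) * y ≡ 0ℤ
    cancel = solve-∀

  sum-survivors : ∀ t → t zero ≡ 0ℤ → t (suc p) ≡ 0ℤ → sum t ≡ sum (t ∘ survivor)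
  sum-survivors t t₀≡0 tₚ≡0 = begin
    sum t                                      ≡⟨ sum-suc t ⟩
    t zero + sum (t ∘ suc)                     ≡⟨ cong (_+ sum (t ∘ suc)) t₀≡0 ⟩
    0ℤ + sum (t ∘ suc)                         ≡⟨ ℤ.+-identityˡ (sum (t ∘ suc)) ⟩
    sum (t ∘ suc)                              ≡⟨ sum-remove p (t ∘ suc) ⟩
    t (suc p) + sum (t ∘ survivor)             ≡⟨ cong (_+ sum (t ∘ survivor)) tₚ≡0 ⟩
    0ℤ + sum (t ∘ survivor)                    ≡⟨ ℤ.+-identityˡ (sum (t ∘ survivor)) ⟩
    sum (t ∘ survivor)                         ∎

  δ-pivot : ∀ i → δ (suc p) (survivor i) ≡ 0ℤ
  δ-pivot i = δ-≢ (punchInᵢ≢i p i ∘ ≡.sym ∘ suc-injective)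

  δ-survivor : ∀ i j → δ (survivor i) (survivor j) ≡ δ i j
  δ-survivor = δ-injective survivor (punchIn-injective p _ _ ∘ suc-injective)

  -- Column zero and row `suc p` of `scaled` vanish, so the two deleted indices contribute nothing
  -- to the product. Of the four entries of `B · B` that arise, three lie off the diagonal and are
  -- zero.
  deflated² : ∀ i j → (deflated · deflated) i j ≡ + (d ℕ.* (∣ β ∣ ℕ.* ∣ β ∣)) * δ i j
  deflated² i j = begin
    (deflated · deflated) i j
      ≡⟨ sum-survivors (λ k → scaled i′ k * scaled k j′)
           (cong (_* scaled zero j′) (scaled-column i′))
           (trans (cong (scaled i′ (suc p) *_) (scaled-row j′)) (ℤ.*-zeroʳ (scaled i′ (suc p)))) ⟨
    sum (λ k → scaled i′ k * scaled k j′)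
      ≡⟨ sum-cong (λ k → swap (scaled i′ k) (β * B k j′) (B k zero) (B (suc p) j′)) ⟩
    sum (λ k → (β * B i′ k + (- B i′ zero) * B (suc p) k) * (β * B k j′ + (- B (suc p) j′) * B k zero))
      ≡⟨ sum-bilinear β (- B i′ zero) β (- B (suc p) j′) (B i′) (B (suc p)) (λ k → B k j′) (λ k → B k zero) ⟩
    β * β * (B · B) i′ j′ + β * (- B (suc p) j′) * (B · B) i′ zero +
      ((- B i′ zero) * β * (B · B) (suc p) j′ + (- B i′ zero) * (- B (suc p) j′) * (B · B) (suc p) zero)
      ≡⟨ cong₂ _+_
           (cong₂ (λ x y → β * β * x + β * (- B (suc p) j′) * y)
             (trans (B²≡d i′ j′) (cong (+ d *_) (δ-survivor i j))) (B²≡d i′ zero))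
           (cong₂ (λ x y → (- B i′ zero) * β * x + (- B i′ zero) * (- B (suc p) j′) * y)
             (trans (B²≡d (suc p) j′) (cong (+ d *_) (δ-pivot j))) (B²≡d (suc p) zero)) ⟩
    β * β * (+ d * δ i j) + β * (- B (suc p) j′) * (+ d * 0ℤ) +
      ((- B i′ zero) * β * (+ d * 0ℤ) + (- B i′ zero) * (- B (suc p) j′) * (+ d * 0ℤ))
      ≡⟨ collect β (+ d) (δ i j) (B i′ zero) (B (suc p) j′) ⟩
    + d * (β * β) * δ i j
      ≡⟨ cong (_* δ i j) (trans (ℤ.pos-* d (∣ β ∣ ℕ.* ∣ β ∣)) (cong (+ d *_) (≡.sym (square-+∣∣ β)))) ⟨
    + (d ℕ.* (∣ β ∣ ℕ.* ∣ β ∣)) * δ i j ∎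
    where
    i′ = survivor i
    j′ = survivor j
    swap : ∀ u v x y → u * (v + (- x) * y) ≡ u * (v + (- y) * x)
    swap = solve-∀
    collect : ∀ b d e x y → b * b * (d * e) + b * (- y) * (d * 0ℤ) +
              ((- x) * b * (d * 0ℤ) + (- x) * (- y) * (d * 0ℤ)) ≡ d * (b * b) * e
    collect = solve-∀

  -- The rank-one correction has trace `(B · B) (suc p) zero`, an off-diagonal entry; the factor `β`
  -- comes from the scaling.
  tr-deflated : tr deflated ≡ β * tr B
  tr-deflated = begin
    tr deflated
      ≡⟨ sum-survivors (λ i → scaled i i) (scaled-column zero) (scaled-row (suc p)) ⟨
    sum (λ i → β * B i i + (- B i zero) * B (suc p) i)
      ≡⟨ sum-cong (λ i → swap (β * B i i) (B i zero) (B (suc p) i)) ⟩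
    sum (λ i → β * B i i + (- 1ℤ) * (B (suc p) i * B i zero))
      ≡⟨ sum-linear β (- 1ℤ) (λ i → B i i) (λ i → B (suc p) i * B i zero) ⟩
    β * tr B + (- 1ℤ) * (B · B) (suc p) zero
      ≡⟨ cong (λ x → β * tr B + (- 1ℤ) * x) (B²≡d (suc p) zero) ⟩
    β * tr B + (- 1ℤ) * (+ d * 0ℤ)
      ≡⟨ drop (β * tr B) (+ d) ⟩
    β * tr B ∎
    where
    swap : ∀ u x y → u + (- x) * y ≡ u + (- 1ℤ) * (y * x)
    swap = solve-∀
    drop : ∀ u d → u + (- 1ℤ) * (d * 0ℤ) ≡ u
    drop = solve-∀

  inflate : β ≢ 0ℤ → tr deflated ≡ 0ℤ ⊎ (∃[ s ] s ℕ.* s ≡ d ℕ.* (∣ β ∣ ℕ.* ∣ β ∣)) →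
            tr B ≡ 0ℤ ⊎ (∃[ s ] s ℕ.* s ≡ d)
  inflate β≢0 (inj₂ (s , s²≡dβ²)) = inj₂ (square-quotient ∣ β ∣ s d (β≢0 ∘ ℤ.∣i∣≡0⇒i≡0) s²≡dβ²)
  inflate β≢0 (inj₁ tr≡0) with ℤ.i*j≡0⇒i≡0∨j≡0 β (trans (≡.sym tr-deflated) tr≡0)
  ... | inj₁ β≡0 = contradiction β≡0 β≢0
  ... | inj₂ trB≡0 = inj₁ trB≡0

-- If `d` is not a square, the eigenvalues `√d` and `-√d` are conjugate and have equal multiplicity.
-- The induction avoids eigenvalues: the plane spanned by `e₀` and `B e₀` is invariant since `B²` is
-- scalar, `B` has trace zero on it, and the quotient has two dimensions fewer.
trace≡0⊎square : ∀ {n} (B : Matrix n) (d : ℕ) → (∀ i j → (B · B) i j ≡ + d * δ i j) →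
                 tr B ≡ 0ℤ ⊎ ∃[ s ] s ℕ.* s ≡ d
trace≡0⊎square {zero} B d B²≡d = inj₁ (sum-empty (λ i → B i i))
trace≡0⊎square {suc n} B d B²≡d with any? (λ p → ¬? (B (suc p) zero ℤ.≟ 0ℤ))
-- Here `e₀` is an eigenvector, and its eigenvalue is an integer root of `d`.
trace≡0⊎square {suc n} B d B²≡d | no ¬pivot = inj₂ (∣ B zero zero ∣ , ℤ.+-injective (begin
  + (∣ B zero zero ∣ ℕ.* ∣ B zero zero ∣)  ≡⟨ square-+∣∣ (B zero zero) ⟨
  B zero zero * B zero zero                ≡⟨ ℤ.+-identityʳ (B zero zero * B zero zero) ⟨
  B zero zero * B zero zero + 0ℤ           ≡⟨ cong (_+_ (B zero zero * B zero zero)) (sum-zero (λ k → B zero (suc k) * B (suc k) zero)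
                                                λ k → trans (cong (B zero (suc k) *_) (column≡0 k)) (ℤ.*-zeroʳ (B zero (suc k)))) ⟨
  B zero zero * B zero zero + sum (λ k → B zero (suc k) * B (suc k) zero)
                                           ≡⟨ sum-suc (λ k → B zero k * B k zero) ⟨
  (B · B) zero zero                        ≡⟨ B²≡d zero zero ⟩
  + d * 1ℤ                                 ≡⟨ ℤ.*-identityʳ (+ d) ⟩
  + d                                      ∎))
  where
  open ≡-Reasoning
  column≡0 : ∀ k → B (suc k) zero ≡ 0ℤ
  column≡0 k = decidable-stable (B (suc k) zero ℤ.≟ 0ℤ) λ ≢0 → ¬pivot (k , ≢0)
trace≡0⊎square {suc (suc n)} B d B²≡d | yes (p , β≢0) =
  inflate β≢0 (trace≡0⊎square deflated (d ℕ.* (∣ β ∣ ℕ.* ∣ β ∣)) deflated²)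
  where open Deflation B d B²≡d p

sum-natural : ∀ {n} (t : Fin n → ℤ) → (∀ i → ∃[ m ] t i ≡ + m) → ∃[ m ] sum t ≡ + m
sum-natural {zero} t nat = 0 , sum-empty t
sum-natural {suc n} t nat with nat zero | sum-natural (t ∘ suc) (nat ∘ suc)
... | x , t₀≡x | y , rest≡y = x ℕ.+ y , trans (sum-suc t) (cong₂ _+_ t₀≡x rest≡y)

sum-natural-≥2 : ∀ {n} {x y : Fin n} → x ≢ y → (t : Fin n → ℤ) → (∀ i → ∃[ m ] t i ≡ + m) →
                 t x ≡ 1ℤ → t y ≡ 1ℤ → ∃[ m ] sum t ≡ + (2 ℕ.+ m)
sum-natural-≥2 {suc zero} {zero} {zero} x≢y = contradiction refl x≢y
sum-natural-≥2 {suc (suc n)} {x} {y} x≢y t nat tx≡1 ty≡1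
  with sum-natural (t ∘ punchIn x ∘ punchIn (punchOut x≢y)) (λ i → nat _)
... | m , rest≡m = m , (begin
  sum t                                            ≡⟨ sum-remove x t ⟩
  t x + sum t₁                                     ≡⟨ cong₂ _+_ tx≡1 (sum-remove (punchOut x≢y) t₁) ⟩
  1ℤ + (t₁ (punchOut x≢y) + sum (t₁ ∘ punchIn (punchOut x≢y)))
    ≡⟨ cong (λ z → 1ℤ + z) (cong₂ _+_ (trans (cong t (punchIn-punchOut x≢y)) ty≡1) rest≡m) ⟩
  + (2 ℕ.+ m)                                      ∎)
  where
  open ≡-Reasoning
  t₁ = t ∘ punchIn x

-- Strongly regular graphs

adjacency : ∀ {n} → Graph n → Matrix n
adjacency G u v = [ adj-dec G u v ]

degree : ∀ {n} → Graph n → Fin n → ℤ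
degree G u = sum (adjacency G u)

common : ∀ {n} → Graph n → Matrix n
common G = adjacency G · adjacency G

module _ {n} (G : Graph n) where
  private a = adjacency G

  adjacency-1 : ∀ {u v} → Adj G u v → a u v ≡ 1ℤ
  adjacency-1 {u} {v} uv with adj-dec G u v
  ... | yes _ = refl
  ... | no ¬uv = contradiction uv ¬uv

  adjacency-0 : ∀ {u v} → ¬ Adj G u v → a u v ≡ 0ℤ
  adjacency-0 {u} {v} ¬uv with adj-dec G u v
  ... | yes uv = contradiction uv ¬uv
  ... | no _ = refl

  adjacency-sym : ∀ u v → a u v ≡ a v u
  adjacency-sym u v with adj-dec G u v
  ... | yes uv = ≡.sym (adjacency-1 (sym G uv))
  ... | no ¬uv = ≡.sym (adjacency-0 (¬uv ∘ sym G))

  common-sym : ∀ u v → common G u v ≡ common G v u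
  common-sym u v = sum-cong λ w →
    trans (ℤ.*-comm (a u w) (a w v)) (cong₂ _*_ (adjacency-sym w v) (adjacency-sym u w))

  common-refl : ∀ u → common G u u ≡ degree G u
  common-refl u = sum-cong λ w → idempotent w
    where
    idempotent : ∀ w → a u w * a w u ≡ a u w
    idempotent w with adj-dec G u w
    ... | yes uw = trans (ℤ.*-identityˡ (a w u)) (adjacency-1 (sym G uw))
    ... | no _ = refl

  common-term-1 : ∀ {u v w} → Adj G u w → Adj G w v → a u w * a w v ≡ 1ℤ
  common-term-1 uw wv = cong₂ _*_ (adjacency-1 uw) (adjacency-1 wv)

  common-term-0 : ∀ {u v} w → ¬ (Adj G u w × Adj G w v) → a u w * a w v ≡ 0ℤ
  common-term-0 {u} {v} w ¬uwv with adj-dec G u w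
  ... | no _ = refl
  ... | yes uw = trans (ℤ.*-identityˡ (a w v)) (adjacency-0 (¬uwv ∘ (uw ,_)))

  common≡0 : ∀ {u v} → (∀ w → ¬ (Adj G u w × Adj G w v)) → common G u v ≡ 0ℤ
  common≡0 none = sum-zero _ λ w → common-term-0 w (none w)

  common≡1 : ∀ {u v} x → Adj G u x → Adj G x v → (∀ w → Adj G u w → Adj G w v → w ≡ x) → common G u v ≡ 1ℤ
  common≡1 {u} {v} x ux xv unique = trans (sum-cong pointwise) (sum-δ x (λ _ → 1ℤ))
    where
    pointwise : ∀ w → a u w * a w v ≡ δ x w * 1ℤ
    pointwise w with x ≟ w
    ... | yes refl = common-term-1 ux xv
    ... | no x≢w = common-term-0 w λ (uw , wv) → x≢w (≡.sym (unique w uw wv))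

  common≡2 : ∀ {u v} x y → x ≢ y → Adj G u x → Adj G x v → Adj G u y → Adj G y v →
             (∀ w → Adj G u w → Adj G w v → w ≡ x ⊎ w ≡ y) → common G u v ≡ + 2
  common≡2 {u} {v} x y x≢y ux xv uy yv only =
    trans (sum-cong pointwise) (trans (sum-distrib-+ (λ w → δ x w * 1ℤ) (λ w → δ y w * 1ℤ))
      (cong₂ _+_ (sum-δ x (λ _ → 1ℤ)) (sum-δ y (λ _ → 1ℤ))))
    where
    pointwise : ∀ w → a u w * a w v ≡ δ x w * 1ℤ + δ y w * 1ℤ
    pointwise w with x ≟ w | y ≟ w
    ... | yes refl | yes y≡w = contradiction (≡.sym y≡w) x≢y
    ... | yes refl | no _ = common-term-1 ux xv
    ... | no _ | yes refl = common-term-1 uy yv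
    ... | no x≢w | no y≢w = common-term-0 w λ (uw , wv) → case only w uw wv of λ
      { (inj₁ w≡x) → x≢w (≡.sym w≡x) ; (inj₂ w≡y) → y≢w (≡.sym w≡y) }

  common-term-natural : ∀ u v w → ∃[ m ] a u w * a w v ≡ + m
  common-term-natural u v w with adj-dec G u w | adj-dec G w v
  ... | yes _ | yes _ = 1 , refl
  ... | yes _ | no _ = 0 , refl
  ... | no _ | yes _ = 0 , refl
  ... | no _ | no _ = 0 , refl

  common≥2 : ∀ {u v x y} → x ≢ y → Adj G u x → Adj G x v → Adj G u y → Adj G y v → ∃[ m ] common G u v ≡ + (2 ℕ.+ m)
  common≥2 {u} {v} x≢y ux xv uy yv =
    sum-natural-≥2 x≢y (λ w → a u w * a w v) (common-term-natural u v) (common-term-1 ux xv) (common-term-1 uy yv)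

  -- Counting the walks of length three from u to v in two ways.
  moore-degree : (∀ {u v} → Adj G u v → common G u v ≡ 0ℤ) →
                 (∀ {u v} → u ≢ v → ¬ Adj G u v → common G u v ≡ 1ℤ) →
                 ∀ {u v} → ¬ Adj G u v → degree G u ≡ degree G v
  moore-degree triangle-free unique {u} {v} ¬uv with u ≟ v
  ... | yes refl = refl
  ... | no u≢v = begin
    degree G u                  ≡⟨ walks u v ¬uv ⟨
    W u v + common G u v        ≡⟨ cong₂ _+_ W-sym (common-sym u v) ⟩
    W v u + common G v u        ≡⟨ walks v u (¬uv ∘ sym G) ⟩
    degree G v                  ∎
    where
    open ≡-Reasoning
    W : Matrix n
    W u v = sum λ x → a u x * common G x v
    -- A neighbour `x` of `u` is either a neighbour of `v` sharing no neighbour with it, or a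
    -- nonneighbour sharing exactly one; each contributes 1.
    walks : ∀ u v → ¬ Adj G u v → W u v + common G u v ≡ degree G u
    walks u v ¬uv = trans (≡.sym (sum-distrib-+ (λ x → a u x * common G x v) (λ x → a u x * a x v))) (sum-cong step′)
      where
      step′ : ∀ x → a u x * common G x v + a u x * a x v ≡ a u x
      step′ x with adj-dec G u x | adj-dec G x v
      ... | no _ | _ = refl
      ... | yes ux | yes xv = cong (λ z → 1ℤ * z + 1ℤ) (triangle-free xv)
      ... | yes ux | no ¬xv = cong (λ z → 1ℤ * z + 0ℤ) (unique (λ { refl → ¬uv ux }) ¬xv)
    W-sym : W u v ≡ W v u
    W-sym = begin
      sum (λ x → a u x * sum (λ y → a x y * a y v))
        ≡⟨ sum-cong (λ x → *-distribˡ-sum (a u x) (λ y → a x y * a y v)) ⟩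
      sum (λ x → sum (λ y → a u x * (a x y * a y v)))
        ≡⟨ sum-comm (λ x y → a u x * (a x y * a y v)) ⟩
      sum (λ y → sum (λ x → a u x * (a x y * a y v)))
        ≡⟨ sum-cong (λ y → sum-cong (λ x → trans
             (cong₂ _*_ (adjacency-sym u x) (cong₂ _*_ (adjacency-sym x y) (adjacency-sym y v)))
             (reverse (a x u) (a y x) (a v y)))) ⟩
      sum (λ y → sum (λ x → a v y * (a y x * a x u)))
        ≡⟨ sum-cong (λ y → *-distribˡ-sum (a v y) (λ x → a y x * a x u)) ⟨
      sum (λ y → a v y * sum (λ x → a y x * a x u)) ∎
      where
      reverse : ∀ x y z → x * (y * z) ≡ z * (y * x)
      reverse = solve-∀

record StronglyRegular {n} (G : Graph n) (k ℓ μ : ℤ) : Set where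
  field
    regular     : ∀ u → degree G u ≡ k
    adjacent    : ∀ {u v} → Adj G u v → common G u v ≡ ℓ
    nonadjacent : ∀ {u v} → u ≢ v → ¬ Adj G u v → common G u v ≡ μ

  -- Entrywise form of `A² = (k - μ) I + (ℓ - μ) A + μ J`, with `J` the all-ones matrix.
  common-formula : ∀ u v → common G u v ≡ (k - μ) * δ u v + (ℓ - μ) * adjacency G u v + μ
  common-formula u v with u ≟ v | adj-dec G u v
  ... | yes refl | yes uu = contradiction uu (irrefl G)
  ... | yes refl | no _ = trans (trans (common-refl G u) (regular u)) (simplify k ℓ μ)
    where
    simplify : ∀ k ℓ μ → k ≡ (k - μ) * 1ℤ + (ℓ - μ) * 0ℤ + μ
    simplify = solve-∀
  ... | no u≢v | yes uv = trans (adjacent uv) (simplify k ℓ μ)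
    where
    simplify : ∀ k ℓ μ → ℓ ≡ (k - μ) * 0ℤ + (ℓ - μ) * 1ℤ + μ
    simplify = solve-∀
  ... | no u≢v | no ¬uv = trans (nonadjacent u≢v ¬uv) (simplify k ℓ μ)
    where
    simplify : ∀ k ℓ μ → μ ≡ (k - μ) * 0ℤ + (ℓ - μ) * 0ℤ + μ
    simplify = solve-∀

sum-const : ∀ n → sum {n} (λ _ → 1ℤ) ≡ + n
sum-const zero = sum-empty (λ _ → 1ℤ)
sum-const (suc n) = trans (sum-suc (λ _ → 1ℤ)) (cong (λ z → 1ℤ + z) (sum-const n))

module _ {n} {G : Graph n} {k ℓ μ : ℤ} (srg : StronglyRegular G k ℓ μ) where
  open StronglyRegular srg
  open ≡-Reasoning
  private a = adjacency G

  -- Summing row `u` of `common-formula` counts the walks of length two from `u`; by regularity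
  -- there are `k²`.
  degree² : Fin n → k * k ≡ (k - μ) + (ℓ - μ) * k + μ * + n
  degree² u = begin
    k * k
      ≡⟨ cong (_* k) (regular u) ⟨
    degree G u * k
      ≡⟨ *-distribʳ-sum k (a u) ⟩
    sum (λ w → a u w * k)
      ≡⟨ sum-cong (λ w → cong (a u w *_) (regular w)) ⟨
    sum (λ w → a u w * degree G w)
      ≡⟨ sum-cong (λ w → *-distribˡ-sum (a u w) (a w)) ⟩
    sum (λ w → sum (λ v → a u w * a w v))
      ≡⟨ sum-comm (λ w v → a u w * a w v) ⟩
    sum (common G u)
      ≡⟨ sum-cong (λ v → trans (common-formula u v) (reorder (k - μ) (δ u v) (ℓ - μ) (a u v) μ)) ⟩
    sum (λ v → δ u v * (k - μ) + (1ℤ * ((ℓ - μ) * a u v + μ * 1ℤ)))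
      ≡⟨ sum-distrib-+ (λ v → δ u v * (k - μ)) (λ v → 1ℤ * ((ℓ - μ) * a u v + μ * 1ℤ)) ⟩
    sum (λ v → δ u v * (k - μ)) + sum (λ v → 1ℤ * ((ℓ - μ) * a u v + μ * 1ℤ))
      ≡⟨ cong₂ _+_ (sum-δ u (λ _ → k - μ))
           (trans (sum-cong (λ v → ℤ.*-identityˡ ((ℓ - μ) * a u v + μ * 1ℤ))) (sum-linear (ℓ - μ) μ (a u) (λ _ → 1ℤ))) ⟩
    (k - μ) + ((ℓ - μ) * degree G u + μ * sum {n} (λ _ → 1ℤ))
      ≡⟨ cong₂ (λ x y → (k - μ) + ((ℓ - μ) * x + μ * y)) (regular u) (sum-const n) ⟩
    (k - μ) + ((ℓ - μ) * k + μ * + n)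
      ≡⟨ ℤ.+-assoc (k - μ) ((ℓ - μ) * k) (μ * + n) ⟨
    (k - μ) + (ℓ - μ) * k + μ * + n ∎
    where
    reorder : ∀ x d y a m → x * d + y * a + m ≡ d * x + 1ℤ * (y * a + m * 1ℤ)
    reorder = solve-∀

moore-order : ∀ {n ℓ} {G : Graph n} → StronglyRegular G ℓ 0ℤ 1ℤ → Fin n → + n ≡ ℓ * ℓ + 1ℤ
moore-order {n} {ℓ} srg u = trans (isolate ℓ (+ n)) (cong (λ z → z + 1ℤ) (≡.sym (degree² srg u)))
  where
  isolate : ∀ l m → m ≡ (l - 1ℤ) + (0ℤ - 1ℤ) * l + 1ℤ * m + 1ℤ
  isolate = solve-∀

-- The adjacency matrix acts on the quotient by the all-ones vector with minimal polynomial x² - (ℓ - μ) x - (k - μ),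
-- whose discriminant is d; the matrix below is the induced 2 A - (ℓ - μ).
module Discriminant {n} {G : Graph (suc n)} {k ℓ μ : ℤ} (srg : StronglyRegular G k ℓ μ)
                    (d : ℕ) (d≡ : + d ≡ (ℓ - μ) * (ℓ - μ) + + 4 * (k - μ)) where
  open StronglyRegular srg
  open ≡-Reasoning
  private a = adjacency G

  -- Modulo the all-ones vector, a vector is determined by its coordinates minus coordinate zero.
  -- The rows and columns other than zero thus represent `A` on the quotient.
  R : Matrix (suc n)
  R i j = 1ℤ * a i j + (- 1ℤ) * a zero j

  R-zero : ∀ j → R zero j ≡ 0ℤ
  R-zero j = cancel (a zero j)
    where
    cancel : ∀ x → 1ℤ * x + (- 1ℤ) * x ≡ 0ℤ
    cancel = solve-∀

  B : Matrix n
  B i j = + 2 * R (suc i) (suc j) + (μ - ℓ) * δ i j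

  -- Subtracting row zero cancels the constant `μ`, and regularity makes the two terms
  -- `k * a zero j` cancel as well.
  R² : ∀ i j → sum (λ h → R (suc i) (suc h) * R (suc h) (suc j)) ≡ (k - μ) * δ i j + (ℓ - μ) * R (suc i) (suc j)
  R² i j = begin
    sum (λ h → R i′ (suc h) * R (suc h) j′)
      ≡⟨ ℤ.+-identityˡ (sum (λ h → R i′ (suc h) * R (suc h) j′)) ⟨
    0ℤ + sum (λ h → R i′ (suc h) * R (suc h) j′)
      ≡⟨ cong (λ z → z + sum (λ h → R i′ (suc h) * R (suc h) j′))
           (trans (cong (R i′ zero *_) (R-zero j′)) (ℤ.*-zeroʳ (R i′ zero))) ⟨
    R i′ zero * R zero j′ + sum (λ h → R i′ (suc h) * R (suc h) j′)
      ≡⟨ sum-suc (λ h → R i′ h * R h j′) ⟨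
    sum (λ h → R i′ h * R h j′)
      ≡⟨ sum-bilinear 1ℤ (- 1ℤ) 1ℤ (- 1ℤ) (a i′) (a zero) (λ h → a h j′) (λ _ → a zero j′) ⟩
    1ℤ * 1ℤ * common G i′ j′ + 1ℤ * (- 1ℤ) * sum (λ h → a i′ h * a zero j′) +
      ((- 1ℤ) * 1ℤ * common G zero j′ + (- 1ℤ) * (- 1ℤ) * sum (λ h → a zero h * a zero j′))
      ≡⟨ cong₂ _+_
           (cong₂ (λ x y → 1ℤ * 1ℤ * x + 1ℤ * (- 1ℤ) * y)
             (trans (common-formula i′ j′) (cong (λ x → (k - μ) * x + (ℓ - μ) * a i′ j′ + μ) (δ-injective suc suc-injective i j)))
             (row-sum i′))
           (cong₂ (λ x y → (- 1ℤ) * 1ℤ * x + (- 1ℤ) * (- 1ℤ) * y) (common-formula zero j′) (row-sum zero)) ⟩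
    1ℤ * 1ℤ * ((k - μ) * δ i j + (ℓ - μ) * a i′ j′ + μ) + 1ℤ * (- 1ℤ) * (k * a zero j′) +
      ((- 1ℤ) * 1ℤ * ((k - μ) * 0ℤ + (ℓ - μ) * a zero j′ + μ) + (- 1ℤ) * (- 1ℤ) * (k * a zero j′))
      ≡⟨ collect (k - μ) (ℓ - μ) μ (δ i j) (a i′ j′) (a zero j′) (k * a zero j′) ⟩
    (k - μ) * δ i j + (ℓ - μ) * R i′ j′ ∎
    where
    i′ = suc i
    j′ = suc j
    row-sum : ∀ u → sum (λ h → a u h * a zero j′) ≡ k * a zero j′
    row-sum u = trans (≡.sym (*-distribʳ-sum (a zero j′) (a u))) (cong (_* a zero j′) (regular u))
    collect : ∀ x y m e p q r → 1ℤ * 1ℤ * (x * e + y * p + m) + 1ℤ * (- 1ℤ) * r +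
              ((- 1ℤ) * 1ℤ * (x * 0ℤ + y * q + m) + (- 1ℤ) * (- 1ℤ) * r) ≡ x * e + y * (1ℤ * p + (- 1ℤ) * q)
    collect = solve-∀

  -- Completing the square in the quadratic equation `R²`.
  B² : ∀ i j → (B · B) i j ≡ + d * δ i j
  B² i j = begin
    (B · B) i j
      ≡⟨ sum-bilinear (+ 2) (μ - ℓ) (+ 2) (μ - ℓ) (λ h → R (suc i) (suc h)) (δ i) (λ h → R (suc h) (suc j)) (λ h → δ h j) ⟩
    + 2 * + 2 * sum (λ h → R (suc i) (suc h) * R (suc h) (suc j)) + + 2 * (μ - ℓ) * sum (λ h → R (suc i) (suc h) * δ h j) +
      ((μ - ℓ) * + 2 * sum (λ h → δ i h * R (suc h) (suc j)) + (μ - ℓ) * (μ - ℓ) * sum (λ h → δ i h * δ h j))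
      ≡⟨ cong₂ _+_
           (cong₂ (λ x y → + 2 * + 2 * x + + 2 * (μ - ℓ) * y) (R² i j)
             (trans (sum-cong λ h → trans (ℤ.*-comm (R (suc i) (suc h)) (δ h j)) (cong (_* R (suc i) (suc h)) (δ-sym h j)))
               (sum-δ j (λ h → R (suc i) (suc h)))))
           (cong₂ (λ x y → (μ - ℓ) * + 2 * x + (μ - ℓ) * (μ - ℓ) * y)
             (sum-δ i (λ h → R (suc h) (suc j))) (sum-δ i (λ h → δ h j))) ⟩
    + 2 * + 2 * ((k - μ) * δ i j + (ℓ - μ) * R (suc i) (suc j)) + + 2 * (μ - ℓ) * R (suc i) (suc j) +
      ((μ - ℓ) * + 2 * R (suc i) (suc j) + (μ - ℓ) * (μ - ℓ) * δ i j)
      ≡⟨ collect k ℓ μ (δ i j) (R (suc i) (suc j)) ⟩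
    ((ℓ - μ) * (ℓ - μ) + + 4 * (k - μ)) * δ i j
      ≡⟨ cong (_* δ i j) d≡ ⟨
    + d * δ i j ∎
    where
    collect : ∀ k ℓ μ e r → + 2 * + 2 * ((k - μ) * e + (ℓ - μ) * r) + + 2 * (μ - ℓ) * r +
              ((μ - ℓ) * + 2 * r + (μ - ℓ) * (μ - ℓ) * e) ≡ ((ℓ - μ) * (ℓ - μ) + + 4 * (k - μ)) * e
    collect = solve-∀

  -- The adjacency matrix has trace zero and eigenvalue `k` on the all-ones vector, so it has trace
  -- `-k` on the quotient, whose dimension `n` is one less than the order.
  tr-B : tr B ≡ - (+ 2 * k + (ℓ - μ) * + n)
  tr-B = begin
    sum (λ i → B i i)
      ≡⟨ sum-cong (λ i → trans (cong₂ (λ x y → + 2 * (1ℤ * x + (- 1ℤ) * a zero (suc i)) + (μ - ℓ) * y)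
           (a-diagonal (suc i)) (δ-refl i)) (simplify (a zero (suc i)) (μ - ℓ))) ⟩
    sum (λ i → (- + 2) * a zero (suc i) + (μ - ℓ) * 1ℤ)
      ≡⟨ sum-linear (- + 2) (μ - ℓ) (λ i → a zero (suc i)) (λ _ → 1ℤ) ⟩
    (- + 2) * sum (λ i → a zero (suc i)) + (μ - ℓ) * sum {n} (λ _ → 1ℤ)
      ≡⟨ cong₂ (λ x y → (- + 2) * x + (μ - ℓ) * y) row (sum-const n) ⟩
    (- + 2) * k + (μ - ℓ) * + n
      ≡⟨ negate k ℓ μ (+ n) ⟩
    - (+ 2 * k + (ℓ - μ) * + n) ∎
    where
    a-diagonal : ∀ u → a u u ≡ 0ℤ
    a-diagonal u = adjacency-0 G {u} {u} (irrefl G)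
    row : sum (λ i → a zero (suc i)) ≡ k
    row = begin
      sum (λ i → a zero (suc i))                ≡⟨ ℤ.+-identityˡ (sum (λ i → a zero (suc i))) ⟨
      0ℤ + sum (λ i → a zero (suc i))           ≡⟨ cong (_+ sum (λ i → a zero (suc i))) (a-diagonal zero) ⟨
      a zero zero + sum (λ i → a zero (suc i))  ≡⟨ sum-suc (a zero) ⟨
      degree G zero                             ≡⟨ regular zero ⟩
      k                                         ∎
    simplify : ∀ x y → + 2 * (1ℤ * 0ℤ + (- 1ℤ) * x) + y * 1ℤ ≡ (- + 2) * x + y * 1ℤ
    simplify = solve-∀
    negate : ∀ k ℓ μ n → (- + 2) * k + (μ - ℓ) * n ≡ - (+ 2 * k + (ℓ - μ) * n)
    negate = solve-∀

  trace≡0⊎discriminant-square : + 2 * k + (ℓ - μ) * + n ≡ 0ℤ ⊎ ∃[ s ] s ℕ.* s ≡ d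
  trace≡0⊎discriminant-square =
    Sum⊎.map₁ (λ tr≡0 → ℤ.neg-injective {+ 2 * k + (ℓ - μ) * + n} {0ℤ} (trans (≡.sym tr-B) tr≡0)) (trace≡0⊎square B d B²)

-- Arithmetic of the two discriminants

parity : ∀ x → ∃[ h ] (x ≡ h ℕ.* 2 ⊎ x ≡ 1 ℕ.+ h ℕ.* 2)
parity zero = 0 , inj₁ refl
parity (suc x) with parity x
... | h , inj₁ refl = h , inj₂ refl
... | h , inj₂ refl = suc h , inj₁ refl

pronic-even : ∀ h → ∃[ c ] h ℕ.* h ℕ.+ h ≡ c ℕ.* 2
pronic-even zero = 0 , refl
pronic-even (suc h) with pronic-even h
... | c , eq = c ℕ.+ suc h , trans (expand h) (trans (cong (ℕ._+ (h ℕ.* 2 ℕ.+ 2)) eq) (collect c h))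
  where
  expand : ∀ h → suc h ℕ.* suc h ℕ.+ suc h ≡ (h ℕ.* h ℕ.+ h) ℕ.+ (h ℕ.* 2 ℕ.+ 2)
  expand = ℕ-Solver.solve-∀
  collect : ∀ c h → c ℕ.* 2 ℕ.+ (h ℕ.* 2 ℕ.+ 2) ≡ (c ℕ.+ suc h) ℕ.* 2
  collect = ℕ-Solver.solve-∀

double² : ∀ a → (a ℕ.* 2) ℕ.* (a ℕ.* 2) ≡ 4 ℕ.* (a ℕ.* a)
double² = ℕ-Solver.solve-∀

-- Since `2 a` exceeds `x`, its square is at least `(x + 1)²`, which is at most `x² + 3` only for
-- `x ≤ 1`.
4a²≡3+x²⇒x≤1 : ∀ x a → 4 ℕ.* (a ℕ.* a) ≡ 3 ℕ.+ x ℕ.* x → x ℕ.≤ 1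
4a²≡3+x²⇒x≤1 x a 4a²≡3+x² with ℕ.≤-<-connex (a ℕ.* 2) x
... | inj₁ 2a≤x = contradiction (begin-strict
    x ℕ.* x                  <⟨ ℕ.m<n+m (x ℕ.* x) (ℕ.s≤s ℕ.z≤n) ⟩
    3 ℕ.+ x ℕ.* x            ≡⟨ 4a²≡3+x² ⟨
    4 ℕ.* (a ℕ.* a)          ≡⟨ double² a ⟨
    (a ℕ.* 2) ℕ.* (a ℕ.* 2)  ≤⟨ ℕ.*-mono-≤ 2a≤x 2a≤x ⟩
    x ℕ.* x                  ∎) (ℕ.<-irrefl refl)
  where
  open ℕ.≤-Reasoning
... | inj₂ x<2a = ℕ.*-cancelˡ-≤ 2 (ℕ.+-cancelˡ-≤ (1 ℕ.+ x ℕ.* x) (2 ℕ.* x) 2 (begin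
    1 ℕ.+ x ℕ.* x ℕ.+ 2 ℕ.* x  ≡⟨ successor² x ⟨
    suc x ℕ.* suc x            ≤⟨ ℕ.*-mono-≤ x<2a x<2a ⟩
    (a ℕ.* 2) ℕ.* (a ℕ.* 2)    ≡⟨ double² a ⟩
    4 ℕ.* (a ℕ.* a)            ≡⟨ 4a²≡3+x² ⟩
    3 ℕ.+ x ℕ.* x              ≡⟨ split (x ℕ.* x) ⟩
    1 ℕ.+ x ℕ.* x ℕ.+ 2        ∎))
  where
  open ℕ.≤-Reasoning
  successor² : ∀ x → suc x ℕ.* suc x ≡ 1 ℕ.+ x ℕ.* x ℕ.+ 2 ℕ.* x
  successor² = ℕ-Solver.solve-∀
  split : ∀ y → 3 ℕ.+ y ≡ 1 ℕ.+ y ℕ.+ 2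
  split = ℕ-Solver.solve-∀

-- For l = 2 + t: both 4 l - 3 and l (5 l - 4) would be squares. The first forces l to be odd, hence coprime to 5 l - 4,
-- so that l is itself a square a², and 4 a² - 3 is a square only for a = 1.
discriminants-not-both-square : ∀ t x y → x ℕ.* x ≡ 5 ℕ.+ 4 ℕ.* t → y ℕ.* y ≡ (2 ℕ.+ t) ℕ.* (6 ℕ.+ 5 ℕ.* t) → ⊥
discriminants-not-both-square t x y x²≡ y²≡ with parity x
-- An even `x` would make 4 divide `5 + 4 t`, hence 5.
... | h , inj₁ refl = from-no (4 ∣? 5) (∣m+n∣m⇒∣n (divides (h ℕ.* h) (begin
  4 ℕ.* t ℕ.+ 5           ≡⟨ ℕ.+-comm (4 ℕ.* t) 5 ⟩
  5 ℕ.+ 4 ℕ.* t           ≡⟨ x²≡ ⟨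
  h ℕ.* 2 ℕ.* (h ℕ.* 2)   ≡⟨ regroup h ⟩
  h ℕ.* h ℕ.* 4           ∎)) (m∣m*n t))
  where
  open ≡-Reasoning
  regroup : ∀ h → h ℕ.* 2 ℕ.* (h ℕ.* 2) ≡ h ℕ.* h ℕ.* 4
  regroup = ℕ-Solver.solve-∀
... | h , inj₂ refl with pronic-even h
...   | c , h²+h≡2c with coprime-factor-square l k y (λ ()) l⊥k (≡.sym y²≡)
  where
  l = 2 ℕ.+ t
  k = 6 ℕ.+ 5 ℕ.* t

  -- For `x = 2 h + 1` the first equation says `l = 1 + h (h + 1)`.
  l≡1+2c : l ≡ 1 ℕ.+ c ℕ.* 2
  l≡1+2c = ℕ.*-cancelˡ-≡ _ _ 4 (ℕ.+-cancelˡ-≡ 1 _ _ (begin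
    1 ℕ.+ 4 ℕ.* (2 ℕ.+ t)                   ≡⟨ shift t ⟩
    4 ℕ.+ (5 ℕ.+ 4 ℕ.* t)                   ≡⟨ cong (4 ℕ.+_) x²≡ ⟨
    4 ℕ.+ (1 ℕ.+ h ℕ.* 2) ℕ.* (1 ℕ.+ h ℕ.* 2) ≡⟨ square h ⟩
    1 ℕ.+ 4 ℕ.* (1 ℕ.+ (h ℕ.* h ℕ.+ h))     ≡⟨ cong (λ z → 1 ℕ.+ 4 ℕ.* (1 ℕ.+ z)) h²+h≡2c ⟩
    1 ℕ.+ 4 ℕ.* (1 ℕ.+ c ℕ.* 2)             ∎))
    where
    open ≡-Reasoning
    shift : ∀ t → 1 ℕ.+ 4 ℕ.* (2 ℕ.+ t) ≡ 4 ℕ.+ (5 ℕ.+ 4 ℕ.* t)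
    shift = ℕ-Solver.solve-∀
    square : ∀ h → 4 ℕ.+ (1 ℕ.+ h ℕ.* 2) ℕ.* (1 ℕ.+ h ℕ.* 2) ≡ 1 ℕ.+ 4 ℕ.* (1 ℕ.+ (h ℕ.* h ℕ.+ h))
    square = ℕ-Solver.solve-∀

  -- A common divisor divides `5 l - k = 4`, then `2 l - 4 c = 2`, then `l - 2 c = 1`.
  l⊥k : Coprime l k
  l⊥k {d} (d∣l , d∣k) = ∣1⇒≡1 (∣m+n∣m⇒∣n (subst (d ∣_) (trans l≡1+2c (ℕ.+-comm 1 (c ℕ.* 2))) d∣l) (∣n⇒∣m*n c d∣2))
    where
    5l≡k+4 : ∀ t → 5 ℕ.* (2 ℕ.+ t) ≡ (6 ℕ.+ 5 ℕ.* t) ℕ.+ 4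
    5l≡k+4 = ℕ-Solver.solve-∀
    2l≡4c+2 : ∀ c → 2 ℕ.* (1 ℕ.+ c ℕ.* 2) ≡ c ℕ.* 4 ℕ.+ 2
    2l≡4c+2 = ℕ-Solver.solve-∀
    d∣4 : d ∣ 4
    d∣4 = ∣m+n∣m⇒∣n (subst (d ∣_) (5l≡k+4 t) (∣n⇒∣m*n 5 d∣l)) d∣k
    d∣2 : d ∣ 2
    d∣2 = ∣m+n∣m⇒∣n (subst (d ∣_) (trans (cong (2 ℕ.*_) l≡1+2c) (2l≡4c+2 c)) (∣n⇒∣m*n 2 d∣l)) (∣n⇒∣m*n c d∣4)
...     | a , a²≡l = contradiction (subst (ℕ._≤ 1) x²≡ (ℕ.*-mono-≤ x≤1 x≤1)) λ { (ℕ.s≤s ()) }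
  where
  shift : ∀ t → 4 ℕ.* (2 ℕ.+ t) ≡ 3 ℕ.+ (5 ℕ.+ 4 ℕ.* t)
  shift = ℕ-Solver.solve-∀
  x≤1 : 1 ℕ.+ h ℕ.* 2 ℕ.≤ 1
  x≤1 = 4a²≡3+x²⇒x≤1 (1 ℕ.+ h ℕ.* 2) a (trans (cong (4 ℕ.*_) a²≡l) (trans (shift t) (cong (3 ℕ.+_) (≡.sym x²≡))))

12-nonsquare : ∀ y → y ℕ.* y ≢ 12
12-nonsquare 0 ()
12-nonsquare 1 ()
12-nonsquare 2 ()
12-nonsquare 3 ()
12-nonsquare (suc (suc (suc (suc y)))) y²≡12 = contradiction (subst (16 ℕ.≤_) y²≡12 (ℕ.*-mono-≤ 4≤ 4≤)) (from-no (16 ℕ.≤? 12))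
  where
  4≤ : 4 ℕ.≤ 4 ℕ.+ y
  4≤ = ℕ.m≤m+n 4 y

-- Let `l = 2 + t`. The trace expression of `H` is positive, so its discriminant is a square. If
-- that of `L` vanishes, then `l² = 2 l`, so `l = 2` and the discriminant of `H` is 12; otherwise
-- both discriminants are squares.
infeasible : ∀ {m n} t {L : Graph m} {H : Graph n} → Fin m → StronglyRegular L (+ (2 ℕ.+ t)) 0ℤ 1ℤ →
             StronglyRegular H (+ m) (+ (2 ℕ.+ t)) (+ 2) → Fin n → ⊥
infeasible {suc m} {suc n} t u srg-L srg-H _ = conclude
  (Discriminant.trace≡0⊎discriminant-square srg-L (5 ℕ.+ 4 ℕ.* t) d-L)
  (Discriminant.trace≡0⊎discriminant-square srg-H ((2 ℕ.+ t) ℕ.* (6 ℕ.+ 5 ℕ.* t)) d-H)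
  where
  open ≡-Reasoning
  τ = + t

  d-L : + (5 ℕ.+ 4 ℕ.* t) ≡ (0ℤ - 1ℤ) * (0ℤ - 1ℤ) + + 4 * (+ (2 ℕ.+ t) - 1ℤ)
  d-L = trans (cong (λ z → + 5 + z) (ℤ.pos-* 4 t)) (solved τ)
    where
    solved : ∀ τ → + 5 + + 4 * τ ≡ (0ℤ - 1ℤ) * (0ℤ - 1ℤ) + + 4 * ((+ 2 + τ) - 1ℤ)
    solved = solve-∀

  order : + suc m ≡ (+ 2 + τ) * (+ 2 + τ) + 1ℤ
  order = moore-order srg-L u

  d-H : + ((2 ℕ.+ t) ℕ.* (6 ℕ.+ 5 ℕ.* t)) ≡
        (+ (2 ℕ.+ t) - + 2) * (+ (2 ℕ.+ t) - + 2) + + 4 * (+ suc m - + 2)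
  d-H = begin
    + ((2 ℕ.+ t) ℕ.* (6 ℕ.+ 5 ℕ.* t))
      ≡⟨ trans (ℤ.pos-* (2 ℕ.+ t) (6 ℕ.+ 5 ℕ.* t)) (cong (λ z → (+ 2 + τ) * (+ 6 + z)) (ℤ.pos-* 5 t)) ⟩
    (+ 2 + τ) * (+ 6 + + 5 * τ)
      ≡⟨ solved τ ⟩
    ((+ 2 + τ) - + 2) * ((+ 2 + τ) - + 2) + + 4 * (((+ 2 + τ) * (+ 2 + τ) + 1ℤ) - + 2)
      ≡⟨ cong (λ z → ((+ 2 + τ) - + 2) * ((+ 2 + τ) - + 2) + + 4 * (z - + 2)) order ⟨
    ((+ 2 + τ) - + 2) * ((+ 2 + τ) - + 2) + + 4 * (+ suc m - + 2) ∎
    where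
    solved : ∀ τ → (+ 2 + τ) * (+ 6 + + 5 * τ) ≡
             ((+ 2 + τ) - + 2) * ((+ 2 + τ) - + 2) + + 4 * (((+ 2 + τ) * (+ 2 + τ) + 1ℤ) - + 2)
    solved = solve-∀

  trace-H≢0 : + 2 * + suc m + (+ (2 ℕ.+ t) - + 2) * + n ≢ 0ℤ
  trace-H≢0 tr≡0 = contradiction (ℤ.+-injective (trans (≡.sym natural) tr≡0)) λ ()
    where
    natural : + 2 * + suc m + (+ (2 ℕ.+ t) - + 2) * + n ≡ + (2 ℕ.* suc m ℕ.+ t ℕ.* n)
    natural = trans (cong₂ (λ x y → x + y * + n) (≡.sym (ℤ.pos-* 2 (suc m))) (cancel τ))
                    (cong (λ z → + (2 ℕ.* suc m) + z) (≡.sym (ℤ.pos-* t n)))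
      where
      cancel : ∀ τ → (+ 2 + τ) - + 2 ≡ τ
      cancel = solve-∀

  trace-L≡0⇒t≡0 : + 2 * + (2 ℕ.+ t) + (0ℤ - 1ℤ) * + m ≡ 0ℤ → t ≡ 0
  trace-L≡0⇒t≡0 tr≡0 = ℕ.m*n≡0⇒m≡0 t (2 ℕ.+ t) (ℤ.+-injective (begin
    + (t ℕ.* (2 ℕ.+ t))                ≡⟨ ℤ.pos-* t (2 ℕ.+ t) ⟩
    τ * (+ 2 + τ)                      ≡⟨ isolate τ (+ m) ⟩
    ((+ 2 + τ) * (+ 2 + τ) + 1ℤ) - (1ℤ + + m) - (+ 2 * (+ 2 + τ) + (0ℤ - 1ℤ) * + m)
                                       ≡⟨ cong₂ (λ x y → x - (1ℤ + + m) - y) (≡.sym order) tr≡0 ⟩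
    + suc m - + suc m - 0ℤ             ≡⟨ vanish (+ suc m) ⟩
    0ℤ                                 ∎))
    where
    isolate : ∀ τ m → τ * (+ 2 + τ) ≡ ((+ 2 + τ) * (+ 2 + τ) + 1ℤ) - (1ℤ + m) - (+ 2 * (+ 2 + τ) + (0ℤ - 1ℤ) * m)
    isolate = solve-∀
    vanish : ∀ x → x - x - 0ℤ ≡ 0ℤ
    vanish = solve-∀

  conclude : + 2 * + (2 ℕ.+ t) + (0ℤ - 1ℤ) * + m ≡ 0ℤ ⊎ (∃[ x ] x ℕ.* x ≡ 5 ℕ.+ 4 ℕ.* t) →
             + 2 * + suc m + (+ (2 ℕ.+ t) - + 2) * + n ≡ 0ℤ ⊎ (∃[ y ] y ℕ.* y ≡ (2 ℕ.+ t) ℕ.* (6 ℕ.+ 5 ℕ.* t)) → ⊥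
  conclude _ (inj₁ tr≡0) = trace-H≢0 tr≡0
  conclude (inj₁ tr≡0) (inj₂ (y , y²≡)) =
    12-nonsquare y (trans y²≡ (cong (λ t → (2 ℕ.+ t) ℕ.* (6 ℕ.+ 5 ℕ.* t)) (trace-L≡0⇒t≡0 tr≡0)))
  conclude (inj₂ (x , x²≡)) (inj₂ (y , y²≡)) = discriminants-not-both-square t x y x²≡ y²≡

-- Graphs without an induced house

-- `sum-elem` trades a sum over the listed elements for an indicator-weighted sum over all vertices,
-- so that degrees in a link become numbers of common neighbours.
record Enumeration {n} {P : Fin n → Set} (P? : ∀ i → Dec (P i)) : Set where
  field
    size      : ℕ
    elem      : Fin size → Fin n
    injective : ∀ {i j} → elem i ≡ elem j → i ≡ j
    sound     : ∀ j → P (elem j)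
    complete  : ∀ i → P i → ∃[ j ] elem j ≡ i
    sum-elem  : (g : Fin n → ℤ) → sum (λ j → g (elem j)) ≡ sum (λ i → [ P? i ] * g i)

  size< : ∀ {i} → ¬ P i → size ℕ.< n
  size< {i} ¬Pi = injective⇒≤ {f = extended} extended-injective
    where
    extended : Fin (suc size) → Fin n
    extended zero = i
    extended (suc j) = elem j
    extended-injective : ∀ {j k} → extended j ≡ extended k → j ≡ k
    extended-injective {zero} {zero} _ = refl
    extended-injective {zero} {suc k} refl = contradiction (sound k) ¬Pi
    extended-injective {suc j} {zero} refl = contradiction (sound j) ¬Pi
    extended-injective {suc j} {suc k} eq = cong suc (injective eq)

enumerate : ∀ {n} {P : Fin n → Set} (P? : ∀ i → Dec (P i)) → Enumeration P?
enumerate {zero} P? = record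
  { size = 0 ; elem = λ j → j ; injective = λ eq → eq ; sound = λ () ; complete = λ ()
  ; sum-elem = λ g → trans (sum-empty g) (≡.sym (sum-empty (λ i → [ P? i ] * g i))) }
enumerate {suc n} {P} P? with P? zero in P?0≡ | enumerate (P? ∘ suc)
... | no ¬P0 | rest = record
  { size = size
  ; elem = suc ∘ elem
  ; injective = injective ∘ suc-injective
  ; sound = sound
  ; complete = λ { zero P0 → contradiction P0 ¬P0
                 ; (suc i) Pi → let (j , eq) = complete i Pi in j , cong suc eq }
  ; sum-elem = λ g → begin
      sum (λ j → g (suc (elem j)))                         ≡⟨ sum-elem (g ∘ suc) ⟩
      sum (λ i → [ P? (suc i) ] * g (suc i))               ≡⟨ ℤ.+-identityˡ (sum (λ i → [ P? (suc i) ] * g (suc i))) ⟨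
      0ℤ * g zero + sum (λ i → [ P? (suc i) ] * g (suc i)) ≡⟨ cong (λ d → [ d ] * g zero + sum (λ i → [ P? (suc i) ] * g (suc i))) P?0≡ ⟨
      [ P? zero ] * g zero + sum (λ i → [ P? (suc i) ] * g (suc i)) ≡⟨ sum-suc (λ i → [ P? i ] * g i) ⟨
      sum (λ i → [ P? i ] * g i)                           ∎
  }
  where open ≡-Reasoning ; open Enumeration rest
... | yes P0 | rest = record
  { size = suc size
  ; elem = elem′
  ; injective = injective′
  ; sound = λ { zero → P0 ; (suc j) → sound j }
  ; complete = λ { zero _ → zero , refl
                 ; (suc i) Pi → let (j , eq) = complete i Pi in suc j , cong suc eq }
  ; sum-elem = λ g → begin
      sum (λ j → g (elem′ j))                              ≡⟨ sum-suc (λ j → g (elem′ j)) ⟩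
      g zero + sum (λ j → g (suc (elem j)))                ≡⟨ cong₂ _+_ (≡.sym (ℤ.*-identityˡ (g zero))) (sum-elem (g ∘ suc)) ⟩
      1ℤ * g zero + sum (λ i → [ P? (suc i) ] * g (suc i)) ≡⟨ cong (λ d → [ d ] * g zero + sum (λ i → [ P? (suc i) ] * g (suc i))) P?0≡ ⟨
      [ P? zero ] * g zero + sum (λ i → [ P? (suc i) ] * g (suc i)) ≡⟨ sum-suc (λ i → [ P? i ] * g i) ⟨
      sum (λ i → [ P? i ] * g i)                           ∎
  }
  where
  open ≡-Reasoning
  open Enumeration rest
  elem′ : Fin (suc size) → Fin (suc n)
  elem′ zero = zero
  elem′ (suc j) = suc (elem j)
  injective′ : ∀ {i j} → elem′ i ≡ elem′ j → i ≡ j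
  injective′ {zero} {zero} _ = refl
  injective′ {suc i} {suc j} eq = cong suc (injective (suc-injective eq))

induce : ∀ {m n} → Graph n → (Fin m → Fin n) → Graph m
induce H f = record
  { Adj = λ i j → Adj H (f i) (f j)
  ; adj-dec = λ i j → adj-dec H (f i) (f j)
  ; sym = sym H
  ; irrefl = irrefl H
  }

TriangleFree : ∀ {n} → Graph n → Set
TriangleFree H = ∀ {x y z} → Adj H x y → Adj H x z → ¬ Adj H y z

module Notation {n} (H : Graph n) where
  infix 4 _~_ _≁_ _~?_
  _~_ _≁_ : Fin n → Fin n → Set
  u ~ v = Adj H u v
  u ≁ v = ¬ Adj H u v

  _~?_ : ∀ u v → Dec (u ~ v)
  _~?_ = adj-dec H

  ~-sym : ∀ {u v} → u ~ v → v ~ u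
  ~-sym = sym H

  ≁-sym : ∀ {u v} → u ≁ v → v ≁ u
  ≁-sym ¬uv vu = ¬uv (~-sym vu)

-- H is the complement of the graph in question, and u ≁ v includes the case u ≡ v; in each field all
-- the required inequalities of vertices follow from the adjacencies.
record Critical {n} (H : Graph n) : Set where
  open Notation H
  field
    house-free : ∀ {v₁ v₂ v₃ v₄ v₅} → v₁ ~ v₃ → v₁ ~ v₄ → v₁ ~ v₅ → v₂ ~ v₄ → v₂ ~ v₅ → v₃ ~ v₅ →
                 v₁ ≁ v₂ → v₂ ≁ v₃ → v₃ ≁ v₄ → v₄ ≁ v₅ → ⊥
    codiameter : ∀ {u v} → u ~ v → ∃[ w ] w ≁ u × w ≁ v
    extension  : ∀ {a b c} → a ~ c → a ≁ b → c ≁ b → ∃[ d ] d ~ a × d ~ b × d ≁ c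

-- Links inherit criticality

module Link {n} {H : Graph n} (critical : Critical H) where
  open Critical critical
  open Notation H

  -- If the `d` given by `extension` were not adjacent to `v`, then `v, d, c, b, a` would be a
  -- house, listed here and below along the path in its complement.
  link-extension : ∀ {v a b c} → v ~ a → v ~ b → v ~ c → a ~ c → a ≁ b → c ≁ b → ∃[ d ] v ~ d × d ~ a × d ~ b × d ≁ c
  link-extension {v} va vb vc ac ¬ab ¬cb with extension ac ¬ab ¬cb
  ... | d , da , db , ¬dc with v ~? d
  ...   | yes vd = d , vd , da , db , ¬dc
  ...   | no ¬vd = ⊥-elim (house-free vc vb va db da (~-sym ac) ¬vd ¬dc ¬cb (≁-sym ¬ab))

  -- If `w` lies outside the link, extending the edges `v p` and `v q` against `w` gives neighbours
  -- `p′` and `q′` of `v` and `w`, nonadjacent to `p` and `q` respectively. One of them serves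
  -- unless `p′ ~ q` and `q′ ~ p`.
  link-codiameter : ∀ {v p q} → v ~ p → v ~ q → p ~ q → ∃[ w ] v ~ w × w ≁ p × w ≁ q
  link-codiameter {v} {p} {q} vp vq pq with codiameter pq
  ... | w , ¬wp , ¬wq with v ~? w
  ...   | yes vw = w , vw , ¬wp , ¬wq
  ...   | no ¬vw with extension vp ¬vw (≁-sym ¬wp) | extension vq ¬vw (≁-sym ¬wq)
  ...     | p′ , p′v , p′w , ¬p′p | q′ , q′v , q′w , ¬q′q with p′ ~? q | q′ ~? p | p′ ~? q′
  ...       | no ¬p′q | _ | _ = p′ , ~-sym p′v , ¬p′p , ¬p′q
  ...       | yes _ | no ¬q′p | _ = q′ , ~-sym q′v , ¬q′p , ¬q′q
  -- The house is `p′, p, w, q, q′`.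
  ...       | yes p′q | yes q′p | yes p′q′ =
    ⊥-elim (house-free p′w p′q p′q′ pq (~-sym q′p) (~-sym q′w) ¬p′p (≁-sym ¬wp) ¬wq (≁-sym ¬q′q))
  -- The new vertex `e` either serves or makes `p, p′, q′, q, e` a house.
  ...       | yes p′q | yes q′p | no ¬p′q′ with link-extension (~-sym p′v) (~-sym q′v) vq p′q ¬p′q′ (≁-sym ¬q′q)
  ...         | e , ve , ep′ , eq′ , ¬eq with e ~? p
  ...           | no ¬ep = e , ve , ¬ep , ¬eq
  ...           | yes ep =
    ⊥-elim (house-free (~-sym q′p) pq (~-sym ep) p′q (~-sym ep′) (~-sym eq′) (≁-sym ¬p′p) ¬p′q′ ¬q′q (≁-sym ¬eq))

  link : ∀ v → Enumeration (adj-dec H v)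
  link v = enumerate (adj-dec H v)

  linkGraph : ∀ v → Graph (Enumeration.size (link v))
  linkGraph v = induce H (Enumeration.elem (link v))

  link-critical : ∀ v → Critical (linkGraph v)
  link-critical v = record
    { house-free = house-free
    ; codiameter = λ {i} {j} ij → lift₂ (link-codiameter (sound i) (sound j) ij)
    ; extension = λ {i} {j} {k} ik ¬ij ¬kj → lift₃ (link-extension (sound i) (sound j) (sound k) ik ¬ij ¬kj)
    }
    where
    open Enumeration (link v)
    lift₂ : ∀ {p q} → ∃[ w ] v ~ w × w ≁ p × w ≁ q → ∃[ j ] elem j ≁ p × elem j ≁ q
    lift₂ (w , vw , ¬wp , ¬wq) with complete w vw
    ... | j , refl = j , ¬wp , ¬wq
    lift₃ : ∀ {a b c} → ∃[ d ] v ~ d × d ~ a × d ~ b × d ≁ c → ∃[ j ] elem j ~ a × elem j ~ b × elem j ≁ c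
    lift₃ (d , vd , rest) with complete d vd
    ... | j , refl = j , rest

  link-size< : ∀ v → Enumeration.size (link v) ℕ.< n
  link-size< v = Enumeration.size< (link v) (irrefl H)

-- p is deleted and its twin r takes over its role.
module Twin {n} {H : Graph n} (critical : Critical H) {p r : Fin n} (p≢r : p ≢ r)
            (p⊆r : ∀ {u} → Adj H u p → Adj H u r) (r⊆p : ∀ {u} → Adj H u r → Adj H u p) where
  open Critical critical
  others : Enumeration (λ u → ¬? (u ≟ p))
  others = enumerate (λ u → ¬? (u ≟ p))
  open Enumeration others

  retract : ∀ u → ∃[ j ] (∀ {v} → Adj H (elem j) v → Adj H u v) × (∀ {v} → Adj H u v → Adj H (elem j) v)
  retract u with u ≟ p
  ... | no u≢p = let (j , eq) = complete u u≢p in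
    j , (λ {v} → subst (λ w → Adj H w v) eq) , λ {v} → subst (λ w → Adj H w v) (≡.sym eq)
  ... | yes refl = let (j , eq) = complete r (p≢r ∘ ≡.sym) in
    j , (λ {v} jv → sym H (r⊆p (sym H (subst (λ w → Adj H w v) eq jv)))) ,
        λ {v} pv → subst (λ w → Adj H w v) (≡.sym eq) (sym H (p⊆r (sym H pv)))

  remainder : Graph size
  remainder = induce H elem

  remainder-critical : Critical remainder
  remainder-critical = record
    { house-free = house-free
    ; codiameter = λ uv → let (w , ¬wu , ¬wv) = codiameter uv ; (j , from , to) = retract w in
        j , ¬wu ∘ from , ¬wv ∘ from
    ; extension = λ ac ¬ab ¬cb → let (d , da , db , ¬dc) = extension ac ¬ab ¬cb ; (j , from , to) = retract d in
        j , to da , to db , ¬dc ∘ from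
    }

  remainder-triangle-free : TriangleFree remainder → TriangleFree H
  remainder-triangle-free free {x} {y} {z} xy xz yz =
    let (i , _ , x→i) = retract x ; (j , _ , y→j) = retract y ; (k , _ , z→k) = retract z in
    free {i} {j} {k} (sym H (y→j (sym H (x→i xy)))) (sym H (z→k (sym H (x→i xz)))) (sym H (z→k (sym H (y→j yz))))

  remainder-size< : size ℕ.< n
  remainder-size< = size< (λ p≢p → p≢p refl)

-- A minimal critical graph containing a triangle

module Minimal {n} {H : Graph n} (critical : Critical H)
               (smaller : ∀ {m} → m ℕ.< n → (K : Graph m) → Critical K → TriangleFree K)
               {x y z} (xy : Adj H x y) (xz : Adj H x z) (yz : Adj H y z) where
  open Critical critical
  open Notation H
  open Link critical

  -- The link of `v` is critical and smaller, hence triangle-free.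
  K₄-free : ∀ {v} {p q r} → v ~ p → v ~ q → v ~ r → p ~ q → p ~ r → q ≁ r
  K₄-free {v} {p} {q} {r} vp vq vr pq pr qr with complete p vp | complete q vq | complete r vr
    where open Enumeration (link v)
  ... | i , refl | j , refl | k , refl = smaller (link-size< v) (linkGraph v) (link-critical v) {i} {j} {k} pq pr qr

  InTriangle : Fin n → Set
  InTriangle u = ∃[ p ] ∃[ q ] u ~ p × u ~ q × p ~ q

  -- If `v` is adjacent to neither end of the edge `p q` in the link of `u`, extending that edge
  -- against `v` within the link reaches a neighbour of `v`.
  triangle-on-edge : ∀ {u v} → InTriangle u → u ~ v → ∃[ w ] u ~ w × v ~ w
  triangle-on-edge {u} {v} (p , q , up , uq , pq) uv with v ~? p | v ~? q
  ... | yes vp | _ = p , up , vp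
  ... | no _ | yes vq = q , uq , vq
  ... | no ¬vp | no ¬vq =
    let (d , ud , _ , dv , _) = link-extension up uv uq pq (≁-sym ¬vp) (≁-sym ¬vq) in d , ud , ~-sym dv

  inTriangle-spread : ∀ {u v} → InTriangle u → u ~ v → InTriangle v
  inTriangle-spread {u} Tu uv = let (w , uw , vw) = triangle-on-edge Tu uv in u , w , ~-sym uv , vw , uw

  -- The property spreads along edges, and a vertex adjacent to neither `x` nor `y` shares a
  -- neighbour with `x`.
  inTriangle : ∀ u → InTriangle u
  inTriangle u with x ~? u | y ~? u
  ... | yes xu | _ = inTriangle-spread (y , z , xy , xz , yz) xu
  ... | no _ | yes yu = inTriangle-spread (x , z , ~-sym xy , yz , xz) yu
  ... | no ¬xu | no ¬yu = let (d , dx , du , _) = extension xy ¬xu ¬yu in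
    inTriangle-spread (inTriangle-spread (y , z , xy , xz , yz) (~-sym dx)) du

  common-neighbour : ∀ {u v} → u ≁ v → ∃[ w ] u ~ w × v ~ w
  common-neighbour {u} {v} ¬uv with inTriangle u
  ... | p , _ , up , _ with p ~? v
  ...   | yes pv = p , up , ~-sym pv
  ...   | no ¬pv = let (d , du , dv , _) = extension up ¬uv ¬pv in d , ~-sym du , ~-sym dv

  link-common-neighbour : ∀ {v a b} → v ~ a → v ~ b → a ≁ b → ∃[ w ] v ~ w × a ~ w × b ~ w
  link-common-neighbour {v} {a} {b} va vb ¬ab with triangle-on-edge (inTriangle v) va
  ... | c , vc , ac with c ~? b
  ...   | yes cb = c , vc , ac , ~-sym cb
  ...   | no ¬cb = let (d , vd , da , db , _) = link-extension va vb vc ac ¬ab ¬cb in d , vd , ~-sym da , ~-sym db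

  Common : Fin n → Fin n → Fin n → Set
  Common a b w = a ~ w × b ~ w

  -- Otherwise `a, b, d, q, p` is a house. A vertex exterior to the pair, adjacent to `a` but not to
  -- `b`, thus cannot distinguish nonadjacent common neighbours; this can be chained along
  -- nonadjacencies.
  exterior-homogeneous : ∀ {a b d p q} → a ≁ b → a ~ d → b ≁ d → Common a b p → Common a b q → p ≁ q → d ~ p → d ~ q
  exterior-homogeneous {d = d} {q = q} ¬ab ad ¬bd (ap , bp) (aq , bq) ¬pq dp with d ~? q
  ... | yes dq = dq
  ... | no ¬dq = ⊥-elim (house-free ad aq ap bq bp dp ¬ab ¬bd ¬dq (≁-sym ¬pq))

  -- If the third vertex `c` of a triangle on `a p` is not adjacent to `b`, extending `a c` against
  -- `b` gives a common neighbour `d` not adjacent to `c`. Being exterior, `c` cannot distinguish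
  -- `p` from `d`, so `p` and `d` are adjacent.
  common-edge : ∀ {a b p} → a ≁ b → Common a b p → ∃[ d ] Common a b d × p ~ d
  common-edge {a} {b} {p} ¬ab (ap , bp) with triangle-on-edge (inTriangle a) ap
  ... | c , ac , pc with c ~? b
  ...   | yes cb = c , (ac , ~-sym cb) , pc
  ...   | no ¬cb with extension ac ¬ab ¬cb
  ...     | d , da , db , ¬dc with d ~? p
  ...       | yes dp = d , (~-sym da , ~-sym db) , ~-sym dp
  ...       | no ¬dp = ⊥-elim (¬dc (~-sym
    (exterior-homogeneous ¬ab ac (≁-sym ¬cb) (ap , bp) (~-sym da , ~-sym db) (≁-sym ¬dp) (~-sym pc))))

  -- Suppose `d ≁ q`. An exterior vertex adjacent to `p` is then adjacent to `q` and so to `d`,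
  -- forming a K₄ with `a`, `p`, `d`. Hence `u ≁ p`, and any common neighbour `w` of `u` and `p` in
  -- the link of `a` leads to a K₄.
  common-unmixed : ∀ {a b u p q d} → a ≁ b → a ~ u → b ≁ u →
                   Common a b p → Common a b q → Common a b d → p ≁ q → d ~ p → d ~ q
  common-unmixed {a} {b} {u} {p} {q} {d} ¬ab au ¬bu ap,bp@(ap , _) aq,bq ad,bd@(ad , _) ¬pq dp with d ~? q
  ... | yes dq = dq
  ... | no ¬dq with link-common-neighbour au ap (exterior≁p au ¬bu)
    where
    exterior≁p : ∀ {w} → a ~ w → b ≁ w → w ≁ p
    exterior≁p aw ¬bw wp = K₄-free ad ap aw dp (~-sym wd) (~-sym wp)
      where
      wq = exterior-homogeneous ¬ab aw ¬bw ap,bp aq,bq ¬pq wp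
      wd = exterior-homogeneous ¬ab aw ¬bw aq,bq ad,bd (≁-sym ¬dq) wq
  ...   | w , aw , uw , pw = ⊥-elim (through w aw uw pw)
    where
    through : ∀ w → a ~ w → u ~ w → p ~ w → ⊥
    through w aw uw pw with b ~? w | w ~? d
    ... | no ¬bw | _ = K₄-free ad ap aw dp (~-sym wd) pw
      where
      wq = exterior-homogeneous ¬ab aw ¬bw ap,bp aq,bq ¬pq (~-sym pw)
      wd = exterior-homogeneous ¬ab aw ¬bw aq,bq ad,bd (≁-sym ¬dq) wq
    ... | yes _ | yes wd = K₄-free ad ap aw dp (~-sym wd) pw
    -- Consecutive vertices of `w, d, q, p` are nonadjacent common neighbours, so `u ~ w` carries
    -- over to `d` and `p`.
    ... | yes bw | no ¬wd = K₄-free ad ap au dp (~-sym ud) (~-sym up)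
      where
      ud = exterior-homogeneous ¬ab au ¬bu (aw , bw) ad,bd ¬wd uw
      uq = exterior-homogeneous ¬ab au ¬bu ad,bd aq,bq ¬dq ud
      up = exterior-homogeneous ¬ab au ¬bu aq,bq ap,bp (≁-sym ¬pq) uq

  -- A neighbour of `a` is either common or exterior, and both cases are settled; `p` and `q` are
  -- thus twins in the link of `a`.
  link-twins : ∀ {a b u p q d} → a ≁ b → a ~ u → b ≁ u → Common a b p → Common a b q → p ≁ q → a ~ d → d ~ p → d ~ q
  link-twins {b = b} {d = d} ¬ab au ¬bu ap,bp aq,bq ¬pq ad dp with b ~? d
  ... | yes bd = common-unmixed ¬ab au ¬bu ap,bp aq,bq (ad , bd) ¬pq dp
  ... | no ¬bd = exterior-homogeneous ¬ab ad ¬bd ap,bp aq,bq ¬pq dp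

  -- For `z` outside the link of `a`, the argument moves to the pair `p`, `q`, for which `z` is
  -- exterior. The link of `p` contains an edge `a w`, and a vertex `y` adjacent to neither end.
  twins : ∀ {a b u p q z} → a ≁ b → a ~ u → b ≁ u → Common a b p → Common a b q → p ≁ q → z ~ p → z ~ q
  twins {a} {b} {u} {p} {q} {z} ¬ab au ¬bu ap,bp@(ap , _) aq,bq@(aq , _) ¬pq zp with z ~? q | z ~? a
  ... | yes zq | _ = zq
  ... | no _ | yes za = link-twins ¬ab au ¬bu ap,bp aq,bq ¬pq (~-sym za) zp
  ... | no ¬zq | no ¬za with link-common-neighbour (~-sym ap) (~-sym zp) (≁-sym ¬za)
  ...   | w , pw , aw , zw with link-codiameter (~-sym ap) pw aw
  ...     | y , py , ¬ya , ¬yw with q ~? y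
  -- Now `w` and `y` are nonadjacent common neighbours of `p` and `q`, twins in the link of `p`, yet
  -- `a` is adjacent to `w` alone.
  ...       | yes qy = ⊥-elim (¬ya (~-sym
    (link-twins ¬pq (~-sym zp) (≁-sym ¬zq) (pw , ~-sym wq) (py , qy) (≁-sym ¬yw) (~-sym ap) aw)))
    where
    wq = link-twins ¬ab au ¬bu ap,bp aq,bq ¬pq aw (~-sym pw)
  ...       | no ¬qy with link-common-neighbour py (~-sym ap) ¬ya
  ...         | w′ , pw′ , yw′ , aw′ with w ~? w′
  ...           | yes ww′ = ⊥-elim (K₄-free (~-sym ap) pw pw′ aw aw′ ww′)
  -- The exterior vertex `y` would distinguish the nonadjacent common neighbours `w` and `w′` of `p`
  -- and `q`.
  ...           | no ¬ww′ = ⊥-elim (¬yw (exterior-homogeneous ¬pq py ¬qy (pw′ , ~-sym w′q) (pw , ~-sym wq) (≁-sym ¬ww′) yw′))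
    where
    wq = link-twins ¬ab au ¬bu ap,bp aq,bq ¬pq aw (~-sym pw)
    w′q = link-twins ¬ab au ¬bu ap,bp aq,bq ¬pq aw′ (~-sym pw′)

  -- Otherwise `u` is exterior to the pair `r`, `p`. For a triangle `p q d` and a neighbour `w` of
  -- `p` adjacent to neither `q` nor `d`, the vertices `q` and `w` would be twins in the link of
  -- `r`, but `d` distinguishes them.
  neighbourhood-⊆⇒⊇ : ∀ {p r} → p ≁ r → (∀ {u} → u ~ p → u ~ r) → ∀ {u} → u ~ r → u ~ p
  neighbourhood-⊆⇒⊇ {p} {r} ¬pr p⊆r {u} ur with u ~? p | inTriangle p
  ... | yes up | _ = up
  ... | no ¬up | q , d , pq , pd , qd with link-codiameter pq pd qd
  ...   | w , pw , ¬wq , ¬wd = ⊥-elim (¬wd (~-sym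
    (link-twins (≁-sym ¬pr) (~-sym ur) (≁-sym ¬up) (in-common pq) (in-common pw) (≁-sym ¬wq)
      (proj₁ (in-common pd)) (~-sym qd))))
    where
    in-common : ∀ {v} → p ~ v → Common r p v
    in-common pv = ~-sym (p⊆r (~-sym pv)) , pv

  -- Deleting `p` would leave a smaller critical graph that still contains a triangle.
  twin-free : ∀ {p r} → p ≁ r → (∀ {u} → u ~ p → u ~ r) → p ≡ r
  twin-free {p} {r} ¬pr p⊆r with p ≟ r
  ... | yes p≡r = p≡r
  ... | no p≢r = ⊥-elim (remainder-triangle-free (smaller remainder-size< remainder remainder-critical) xy xz yz)
    where open Twin critical p≢r p⊆r (neighbourhood-⊆⇒⊇ ¬pr p⊆r)

  -- If an exterior vertex exists, `p` and `q` are twins; otherwise `a` and `b` are. With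
  -- K₄-freeness, at most two common neighbours remain.
  common-clique : ∀ {a b p q} → a ≢ b → a ≁ b → Common a b p → Common a b q → p ≁ q → p ≡ q
  common-clique {a} {b} a≢b ¬ab ap,bp aq,bq ¬pq with any? (λ u → (a ~? u) ×-dec ¬? (b ~? u))
  ... | yes (u , au , ¬bu) = twin-free ¬pq (twins ¬ab au ¬bu ap,bp aq,bq ¬pq)
  ... | no ¬∃u = ⊥-elim (a≢b (twin-free ¬ab λ {u} ua →
    decidable-stable (u ~? b) λ ¬ub → ¬∃u (u , ~-sym ua , ≁-sym ¬ub)))

  private
    commonH = common H

  link-degree : ∀ v j → degree (linkGraph v) j ≡ commonH v (Enumeration.elem (link v) j)
  link-degree v j = trans (sum-elem (adjacency H (elem j)))
    (sum-cong λ w → cong (adjacency H v w *_) (adjacency-sym H (elem j) w))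
    where open Enumeration (link v)

  link-adjacent : ∀ v {i j} → Adj (linkGraph v) i j → common (linkGraph v) i j ≡ 0ℤ
  link-adjacent v {i} {j} ij = common≡0 (linkGraph v) {i} {j} λ k (ik , kj) →
    K₄-free (sound i) (sound k) (sound j) ik ij kj
    where open Enumeration (link v)

  -- Adjacent common neighbours in the link would form a K₄ with `v` and `i`; nonadjacent ones are
  -- equal by `common-clique`.
  link-nonadjacent : ∀ v {i j} → i ≢ j → ¬ Adj (linkGraph v) i j → common (linkGraph v) i j ≡ 1ℤ
  link-nonadjacent v {i} {j} i≢j ¬ij with link-common-neighbour (sound i) (sound j) ¬ij
    where open Enumeration (link v)
  ... | w , vw , iw , jw with Enumeration.complete (link v) w vw
  ...   | k , refl = common≡1 (linkGraph v) k iw (~-sym jw) λ h ih hj →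
    injective (common-clique (i≢j ∘ injective) ¬ij (ih , ~-sym hj) (iw , jw)
      (K₄-free (sound i) (sound h) (sound k) ih iw))
    where open Enumeration (link v)

  common-across-nonadjacent : ∀ {v p q} → v ~ p → v ~ q → p ≁ q → commonH v p ≡ commonH v q
  common-across-nonadjacent {v} {p} {q} vp vq ¬pq
    with Enumeration.complete (link v) p vp | Enumeration.complete (link v) q vq
  ... | i , refl | j , refl = trans (≡.sym (link-degree v i))
    (trans (moore-degree (linkGraph v) (λ {i} {j} → link-adjacent v {i} {j}) (link-nonadjacent v) {i} {j} ¬pq)
      (link-degree v j))

  -- Regularity of the link of `v`: adjacent vertices are compared through a third one adjacent to
  -- neither.
  common-locally-constant : ∀ {v p q} → v ~ p → v ~ q → commonH v p ≡ commonH v q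
  common-locally-constant {v} {p} {q} vp vq with p ~? q
  ... | no ¬pq = common-across-nonadjacent vp vq ¬pq
  ... | yes pq = let (w , vw , ¬wp , ¬wq) = link-codiameter vp vq pq in
    trans (common-across-nonadjacent vp vw (≁-sym ¬wp)) (common-across-nonadjacent vw vq ¬wq)

  ℓ : ℤ
  ℓ = commonH x y

  -- The value passes between edges sharing a vertex, and a path of length at most two from `u` to
  -- `x` links `u v` to `x y`.
  common-constant : ∀ {u v} → u ~ v → commonH u v ≡ ℓ
  common-constant {u} {v} uv with u ~? x
  ... | yes ux = trans (common-locally-constant uv ux)
                   (trans (common-sym H u x) (common-locally-constant (~-sym ux) xy))
  ... | no ¬ux = let (w , uw , xw) = common-neighbour ¬ux in
    trans (common-locally-constant uv uw) (trans (common-sym H u w)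
      (trans (common-locally-constant (~-sym uw) (~-sym xw)) (trans (common-sym H w x) (common-locally-constant xw xy))))

  link-stronglyRegular : ∀ v → StronglyRegular (linkGraph v) ℓ 0ℤ 1ℤ
  link-stronglyRegular v = record
    { regular = λ j → trans (link-degree v j) (common-constant (Enumeration.sound (link v) j))
    ; adjacent = λ {i} {j} → link-adjacent v {i} {j}
    ; nonadjacent = link-nonadjacent v
    }

  link-point : ∀ v → Fin (Enumeration.size (link v))
  link-point v with inTriangle v
  ... | p , _ , vp , _ = proj₁ (Enumeration.complete (link v) p vp)

  degree-link : ∀ v → degree H v ≡ + Enumeration.size (link v)
  degree-link v = trans (sum-cong λ w → ≡.sym (ℤ.*-identityʳ (adjacency H v w)))
    (trans (≡.sym (Enumeration.sum-elem (link v) (λ _ → 1ℤ))) (sum-const (Enumeration.size (link v))))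

  stronglyRegular : StronglyRegular H (+ Enumeration.size (link x)) ℓ (+ 2)
  stronglyRegular = record
    { regular = λ u → trans (degree-link u) (trans (link-order u) (≡.sym (link-order x)))
    ; adjacent = common-constant
    ; nonadjacent = nonadjacent
    }
    where
    link-order : ∀ v → + Enumeration.size (link v) ≡ ℓ * ℓ + 1ℤ
    link-order v = moore-order (link-stronglyRegular v) (link-point v)

    nonadjacent : ∀ {u v} → u ≢ v → u ≁ v → commonH u v ≡ + 2
    nonadjacent {u} {v} u≢v ¬uv with common-neighbour ¬uv
    ... | p , up , vp with common-edge ¬uv (up , vp)
    ...   | d , (ud , vd) , pd = common≡2 H p d (λ { refl → irrefl H pd }) up (~-sym vp) ud (~-sym vd) only
      where
      only : ∀ w → u ~ w → w ~ v → w ≡ p ⊎ w ≡ d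
      only w uw wv with w ~? p | w ~? d
      ... | no ¬wp | _ = inj₁ (common-clique u≢v ¬uv (uw , ~-sym wv) (up , vp) ¬wp)
      ... | yes _ | no ¬wd = inj₂ (common-clique u≢v ¬uv (uw , ~-sym wv) (ud , vd) ¬wd)
      ... | yes wp | yes wd = ⊥-elim (K₄-free uw up ud wp wd pd)

  -- Besides `z`, the edge `x y` has the common neighbour `v`, which differs from `z` because `w` is
  -- adjacent to `v` only.
  ℓ≥2 : ∃[ t ] ℓ ≡ + (2 ℕ.+ t)
  ℓ≥2 with link-codiameter xy xz yz
  ... | w , xw , ¬wy , ¬wz with link-common-neighbour xw xy ¬wy
  ...   | v , xv , wv , yv = common≥2 H {x} {y} {z} {v} (λ { refl → ¬wz wv }) xz (~-sym yz) xv (~-sym yv)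

  absurd : ⊥
  absurd = let (t , ℓ≡) = ℓ≥2 in infeasible t (link-point x)
      (subst (λ l → StronglyRegular (linkGraph x) l 0ℤ 1ℤ) ℓ≡ (link-stronglyRegular x))
      (subst (λ l → StronglyRegular H (+ Enumeration.size (link x)) l (+ 2)) ℓ≡ stronglyRegular) x

critical⇒triangle-free : ∀ {n} (H : Graph n) → Critical H → TriangleFree H
critical⇒triangle-free {n} = go (<-wellFounded n)
  where
  go : ∀ {n} → Acc ℕ._<_ n → (H : Graph n) → Critical H → TriangleFree H
  go (acc rs) H critical xy xz yz = Minimal.absurd critical (λ m<n → go (rs m<n)) xy xz yz

-- Passing to the complement

complement : ∀ {n} → Graph n → Graph n
complement G = record
  { Adj = λ u v → u ≢ v × ¬ Adj G u v
  ; adj-dec = λ u v → ¬? (u ≟ v) ×-dec ¬? (adj-dec G u v)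
  ; sym = λ (u≢v , ¬uv) → u≢v ∘ ≡.sym , ¬uv ∘ sym G
  ; irrefl = λ (u≢u , _) → u≢u refl
  }

-- The negated conclusion of the theorem: every induced path `a, b, c` extends beyond `c` to an
-- induced P₄.
Extendable : ∀ {n} → Graph n → Set
Extendable G = ∀ a b c → a ≢ c → Adj G a b → Adj G b c → ¬ Adj G a c →
               ∃[ d ] Adj G c d × ¬ Adj G a d × ¬ Adj G b d

module _ {n} (G : Graph n) (connected : Connected G) (P₅-free : P5Free G) (extendable : Extendable G) where
  open Notation G
  open Notation (complement G) using () renaming (_~_ to _≈_; _≁_ to _≉_)

  ≉⇒≡⊎~ : ∀ {u v} → u ≉ v → u ≡ v ⊎ u ~ v
  ≉⇒≡⊎~ {u} {v} ¬u≈v with u ≟ v | u ~? v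
  ... | yes u≡v | _ = inj₁ u≡v
  ... | no _ | yes uv = inj₂ uv
  ... | no u≢v | no ¬uv = contradiction (u≢v , ¬uv) ¬u≈v

  ~⇒≉ : ∀ {u v} → u ~ v → u ≉ v
  ~⇒≉ uv (_ , ¬uv) = ¬uv uv

  ~⇒≢ : ∀ {u v} → u ~ v → u ≢ v
  ~⇒≢ uv refl = irrefl G uv

  Near : Fin n → Fin n → Set
  Near u v = u ≡ v ⊎ u ~ v ⊎ (∃[ w ] u ~ w × w ~ v)

  -- A distance of three would extend to an induced P₅.
  near-step : ∀ {u w v} → u ~ w → Near w v → Near u v
  near-step uw (inj₁ refl) = inj₂ (inj₁ uw)
  near-step uw (inj₂ (inj₁ wv)) = inj₂ (inj₂ (_ , uw , wv))
  near-step {u} {w} {v} uw (inj₂ (inj₂ (x , wx , xv))) with u ≟ v | u ~? v | u ≟ x | u ~? x | w ≟ v | w ~? v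
  ... | yes u≡v | _ | _ | _ | _ | _ = inj₁ u≡v
  ... | no _ | yes uv | _ | _ | _ | _ = inj₂ (inj₁ uv)
  ... | no _ | no _ | yes refl | _ | _ | _ = inj₂ (inj₁ xv)
  ... | no _ | no _ | no _ | yes ux | _ | _ = inj₂ (inj₂ (x , ux , xv))
  ... | no _ | no _ | no _ | no _ | yes refl | _ = inj₂ (inj₁ uw)
  ... | no _ | no _ | no _ | no _ | no _ | yes wv = inj₂ (inj₂ (w , uw , wv))
  ... | no u≢v | no ¬uv | no u≢x | no ¬ux | no w≢v | no ¬wv with extendable w x v w≢v wx xv ¬wv
  ...   | e , ve , ¬we , ¬xe with u ~? e
  ...     | yes ue = inj₂ (inj₂ (e , ue , ~-sym ve))
  ...     | no ¬ue = ⊥-elim (P₅-free u w x v e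
    ( ~⇒≢ uw , u≢x , u≢v , (λ { refl → ¬uv (~-sym ve) })
    , ~⇒≢ wx , w≢v , (λ { refl → ¬ue uw })
    , ~⇒≢ xv , (λ { refl → ¬we wx })
    , ~⇒≢ ve
    , uw , wx , xv , ve
    , ¬ux , ¬uv , ¬ue
    , ¬wv , ¬we
    , ¬xe ))

  near : ∀ {u v} → Walk G u v → Near u v
  near here = inj₁ refl
  near (step uw walk) = near-step uw (near walk)

  complement-critical : Critical (complement G)
  complement-critical = record
    { house-free = house-free
    ; codiameter = codiameter
    ; extension = extension
    }
    where
    house-free : ∀ {v₁ v₂ v₃ v₄ v₅} → v₁ ≈ v₃ → v₁ ≈ v₄ → v₁ ≈ v₅ → v₂ ≈ v₄ → v₂ ≈ v₅ → v₃ ≈ v₅ →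
                 v₁ ≉ v₂ → v₂ ≉ v₃ → v₃ ≉ v₄ → v₄ ≉ v₅ → ⊥
    house-free {v₁} {v₂} {v₃} {v₄} {v₅} 13≈@(1≢3 , ¬13) 14≈@(1≢4 , ¬14) 15≈@(1≢5 , ¬15) 24≈@(2≢4 , ¬24) 25≈@(2≢5 , ¬25) 35≈@(3≢5 , ¬35) 12≉ 23≉ 34≉ 45≉
      with ≉⇒≡⊎~ 12≉ | ≉⇒≡⊎~ 23≉ | ≉⇒≡⊎~ 34≉ | ≉⇒≡⊎~ 45≉
    -- Under `≉` consecutive vertices may coincide, but each coincidence contradicts one of the
    -- adjacencies.
    ... | inj₁ refl | _ | _ | _ = 23≉ 13≈
    ... | inj₂ _ | inj₁ refl | _ | _ = 12≉ 13≈
    ... | inj₂ _ | inj₂ _ | inj₁ refl | _ = 45≉ 35≈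
    ... | inj₂ _ | inj₂ _ | inj₂ _ | inj₁ refl = 34≉ 35≈
    ... | inj₂ 12~ | inj₂ 23~ | inj₂ 34~ | inj₂ 45~ = P₅-free v₁ v₂ v₃ v₄ v₅
      ( ~⇒≢ 12~ , 1≢3 , 1≢4 , 1≢5 , ~⇒≢ 23~ , 2≢4 , 2≢5 , ~⇒≢ 34~ , 3≢5 , ~⇒≢ 45~
      , 12~ , 23~ , 34~ , 45~ , ¬13 , ¬14 , ¬15 , ¬24 , ¬25 , ¬35 )

    codiameter : ∀ {u v} → u ≈ v → ∃[ w ] w ≉ u × w ≉ v
    codiameter {u} {v} (u≢v , ¬uv) with near (connected u v)
    ... | inj₁ u≡v = contradiction u≡v u≢v
    ... | inj₂ (inj₁ uv) = contradiction uv ¬uv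
    ... | inj₂ (inj₂ (w , uw , wv)) = w , ~⇒≉ (~-sym uw) , ~⇒≉ wv

    extension : ∀ {a b c} → a ≈ c → a ≉ b → c ≉ b → ∃[ d ] d ≈ a × d ≈ b × d ≉ c
    extension {a} {b} {c} ac@(a≢c , ¬ac) ¬ab ¬cb with ≉⇒≡⊎~ ¬ab | ≉⇒≡⊎~ ¬cb
    ... | inj₁ refl | _ = contradiction ((λ c≡a → a≢c (≡.sym c≡a)) , λ ca → ¬ac (~-sym ca)) ¬cb
    ... | inj₂ _ | inj₁ refl = contradiction ac ¬ab
    ... | inj₂ ab | inj₂ cb with extendable a b c a≢c ab (~-sym cb) ¬ac
    ...   | d , cd , ¬ad , ¬bd = d ,
      ((λ { refl → ¬ac (~-sym cd) }) , λ da → ¬ad (~-sym da)) ,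
      ((λ { refl → ¬ad ab }) , λ db → ¬bd (~-sym db)) ,
      ~⇒≉ (~-sym cd)

choose : ∀ {n} k (S : Subset n) → k ℕ.≤ Subset.∣ S ∣ →
         Σ (Fin k → Fin n) λ f → (∀ {i j} → f i ≡ f j → i ≡ j) × (∀ i → f i ∈ S)
choose zero S _ = (λ ()) , (λ { {()} }) , λ ()
choose (suc k) (outside ∷ S) k<∣S∣ =
  let (f , injective , f∈S) = choose (suc k) S k<∣S∣ in suc ∘ f , injective ∘ suc-injective , there ∘ f∈S
choose (suc k) (inside ∷ S) (ℕ.s≤s k≤∣S∣) =
  let (f , injective , f∈S) = choose k S k≤∣S∣ in
  (λ { zero → zero ; (suc i) → suc (f i) }) ,
  (λ { {zero} {zero} _ → refl ; {suc i} {suc j} eq → cong suc (injective (suc-injective eq)) }) ,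
  (λ { zero → here ; (suc i) → there (f∈S i) })

theorem1p2 : ∀ {n : ℕ} (G : Graph n) → Connected G → P5Free G → IndepAtLeast G 3 →
    ∃[ a ] ∃[ b ] ∃[ c ]
    (¬ a ≡ c × Adj G a b × Adj G b c × ¬ Adj G a c ×
    (∀ (d : Fin n) → Adj G c d → Adj G a d ⊎ Adj G b d))
theorem1p2 {n} G connected P₅-free (S , stable , ∣S∣≥3) with any? (λ a → any? (λ b → any? (λ c → good? a b c)))
  where
  open Notation G
  good? : ∀ a b c → Dec (a ≢ c × a ~ b × b ~ c × a ≁ c × (∀ d → c ~ d → a ~ d ⊎ b ~ d))
  good? a b c = ¬? (a ≟ c) ×-dec (a ~? b) ×-dec (b ~? c) ×-dec ¬? (a ~? c) ×-dec
                all? (λ d → (c ~? d) →-dec ((a ~? d) ⊎-dec (b ~? d)))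
... | yes (a , b , c , good) = a , b , c , good
-- Three vertices of the stable set form a triangle of the complement.
... | no ¬good = ⊥-elim (critical⇒triangle-free (complement G) (complement-critical G connected P₅-free extendable)
    {f zero} {f (suc zero)} {f (suc (suc zero))} (apart λ ()) (apart λ ()) (apart λ ()))
  where
  open Notation G

  extendable : Extendable G
  extendable a b c a≢c ab bc ¬ac with any? (λ d → (c ~? d) ×-dec ¬? (a ~? d) ×-dec ¬? (b ~? d))
  ... | yes extension = extension
  ... | no ¬∃d = contradiction (a , b , c , a≢c , ab , bc , ¬ac , dominated) ¬good
    where
    dominated : ∀ d → c ~ d → a ~ d ⊎ b ~ d
    dominated d cd with a ~? d | b ~? d
    ... | yes ad | _ = inj₁ ad
    ... | no _ | yes bd = inj₂ bd
    ... | no ¬ad | no ¬bd = contradiction (d , cd , ¬ad , ¬bd) ¬∃d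

  chosen = choose 3 S ∣S∣≥3
  f = proj₁ chosen

  apart : ∀ {i j} → i ≢ j → Adj (complement G) (f i) (f j)
  apart {i} {j} i≢j = i≢j ∘ proj₁ (proj₂ chosen) , stable (f i) (f j) (proj₂ (proj₂ chosen) i) (proj₂ (proj₂ chosen) j)
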